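{- There is an absolute constant $c>0$ such that for every integer $n\geqslant 3$ there exists a convex $n$-gon $P$ in $\mathbb{R}^2$ all of whose vertices lie in $[2n]\times[4n^2]$ and whose extension complexity satisfies $\mathrm{xc}(P)\geqslant c\,\sqrt{n}/\sqrt{\log n}$. (In other words, $\mathrm{xc}(P)=\Omega(\sqrt{n}/\sqrt{\log n})$.)
   Context: For a positive integer $m$, $[m]:=\{1,2,\ldots,m\}$. A polytope is the convex hull of finitely many points in some $\mathbb{R}^d$. An extension of a polytope $P\subseteq\mathbb{R}^d$ is a polytope $Q\subseteq\mathbb{R}^e$ (for some $e$) such that $P$ is the image of $Q$ under a linear projection $\mathbb{R}^e\to\mathbb{R}^d$. The size of an extension $Q$ is its number of facets. The extension complexity $\mathrm{xc}(P)$ is the minimum size of an extension of $P$. A convex $n$-gon is a convex polygon with exactly $n$ vertices. -}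

module Defs where

open import Algebra.Bundles using (CommutativeRing)
open import Data.Fin.Base using (Fin)
open import Data.Nat.Base as ℕ using (ℕ; suc)
open import Data.Product.Base using (Σ-syntax; ∃; ∃-syntax; _×_)
open import Data.Vec.Functional using (Vector)
open import Function.Definitions using (Injective)
open import Level using (0ℓ) renaming (suc to lsuc)
open import Relation.Binary.Core using (Rel)
open import Relation.Binary.PropositionalEquality.Core using (_≡_)
open import Relation.Binary.Structures using (IsTotalOrder)
open import Relation.Nullary.Negation.Core using (¬_)
open import Relation.Unary using (Pred; _∈_; _⊆_; _≐_; Satisfiable)

-- The elements satisfying P, counted up to _~_, number exactly n.
record HasCardinality {A : Set} (_~_ : Rel A 0ℓ) (P : Pred A 0ℓ) (n : ℕ) : Set where
  field
    enum      : Fin n → A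
    sound     : ∀ i → enum i ∈ P
    injective : Injective _≡_ _~_ enum
    complete  : ∀ {x} → x ∈ P → ∃[ i ] (enum i ~ x)

-- The axioms that characterise the real numbers up to isomorphism.  Any
-- construction of ℝ satisfies them once excluded middle is available.
record CompleteOrderedField : Set (lsuc 0ℓ) where
  field
    commutativeRing : CommutativeRing 0ℓ 0ℓ

  open CommutativeRing commutativeRing public

  infix  4 _≤_ _<_
  infix  9 _⁻¹

  field
    _≤_          : Rel Carrier 0ℓ
    isTotalOrder : IsTotalOrder _≈_ _≤_
    +-monoˡ-≤    : ∀ {x y} z → x ≤ y → x + z ≤ y + z
    *-nonNeg     : ∀ {x y} → 0# ≤ x → 0# ≤ y → 0# ≤ x * y
    0≉1          : ¬ 0# ≈ 1#
    -- 0# ⁻¹ is left unspecified.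
    _⁻¹          : Carrier → Carrier
    *-inverseʳ   : ∀ {x} → ¬ x ≈ 0# → x * x ⁻¹ ≈ 1#

  _<_ : Rel Carrier 0ℓ
  x < y = x ≤ y × ¬ x ≈ y

  IsUpperBound : Pred Carrier 0ℓ → Pred Carrier 0ℓ
  IsUpperBound S u = ∀ {x} → x ∈ S → x ≤ u

  IsSupremum : Pred Carrier 0ℓ → Pred Carrier 0ℓ
  IsSupremum S s = IsUpperBound S s × (∀ {u} → IsUpperBound S u → s ≤ u)

  field
    supremum : ∀ S → Satisfiable S → ∃ (IsUpperBound S) → ∃ (IsSupremum S)

  open import Algebra.Properties.Semiring.Mult semiring
    renaming (_×_ to _×ˢ_) using ()

  fromℕ : ℕ → Carrier
  fromℕ n = n ×ˢ 1#

  IsSqrt : Carrier → Pred Carrier 0ℓ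
  IsSqrt x s = 0# ≤ s × s * s ≈ x

  -- For n ≥ 1, log₂ n is the supremum of the fractions p / q (p ≥ 0, q ≥ 1)
  -- with 2 ^ p ≤ n ^ q, i.e. 2 ^ (p / q) ≤ n.
  IsLog₂ : ℕ → Pred Carrier 0ℓ
  IsLog₂ n = IsSupremum λ r →
    ∃[ p ] ∃[ q ] (1 ℕ.≤ q × 2 ℕ.^ p ℕ.≤ n ℕ.^ q × r * fromℕ q ≈ fromℕ p)

module Polytopes (ℝ : CompleteOrderedField) where

  open CompleteOrderedField ℝ
  open import Algebra.Properties.Semiring.Sum semiring using (sum) public
  open import Data.Vec.Functional.Relation.Binary.Equality.Setoid setoid
    using (_≋_) public

  Point : ℕ → Set
  Point = Vector Carrier

  infix 7 _∙_

  _∙_ : ∀ {d} → Point d → Point d → Carrier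
  x ∙ y = sum λ i → x i * y i

  record Polytope (d : ℕ) : Set where
    field
      {size}    : ℕ
      generator : Fin size → Point d

  record _∈conv_ {d} (x : Point d) (P : Polytope d) : Set where
    open Polytope P
    field
      weight  : Fin size → Carrier
      nonNeg  : ∀ j → 0# ≤ weight j
      sum≈1   : sum weight ≈ 1#
      combine : x ≋ λ i → sum λ j → weight j * generator j i

  ⟦_⟧ : ∀ {d} → Polytope d → Pred (Point d) 0ℓ
  ⟦ P ⟧ x = x ∈conv P

  -- The inequality  normal ∙ x ≤ bound.
  record Inequality (d : ℕ) : Set where
    field
      normal : Point d
      bound  : Carrier

  open Inequality

  Valid : ∀ {d} → Polytope d → Pred (Inequality d) 0ℓ
  Valid P h = ∀ {x} → x ∈ ⟦ P ⟧ → normal h ∙ x ≤ bound h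

  -- The face of P cut out by h, when h is valid for P.
  face : ∀ {d} → Polytope d → Inequality d → Pred (Point d) 0ℓ
  face P h x = x ∈ ⟦ P ⟧ × normal h ∙ x ≈ bound h

  SameFace : ∀ {d} → Polytope d → Rel (Inequality d) 0ℓ
  SameFace P h h′ = face P h ≐ face P h′

  DefinesProperFace : ∀ {d} → Polytope d → Pred (Inequality d) 0ℓ
  DefinesProperFace P h = Valid P h × ¬ (⟦ P ⟧ ⊆ face P h)

  -- A facet is an inclusion-maximal proper face.
  DefinesFacet : ∀ {d} → Polytope d → Pred (Inequality d) 0ℓ
  DefinesFacet P h = DefinesProperFace P h ×
    (∀ {h′} → DefinesProperFace P h′ → face P h ⊆ face P h′ → face P h′ ⊆ face P h)

  -- Different inequalities may define the same facet, hence the count up to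
  -- SameFace.
  HasFacetCount : ∀ {d} → Polytope d → ℕ → Set
  HasFacetCount P = HasCardinality (SameFace P) (DefinesFacet P)

  IsVertex : ∀ {d} → Polytope d → Pred (Point d) 0ℓ
  IsVertex P x = ∃[ h ] (Valid P h × face P h ≐ (_≋ x))

  HasVertexCount : ∀ {d} → Polytope d → ℕ → Set
  HasVertexCount P = HasCardinality _≋_ (IsVertex P)

  -- With at least three vertices, a polytope in the plane is two-dimensional.
  IsConvexGon : ℕ → Pred (Polytope 2) 0ℓ
  IsConvexGon n P = 3 ℕ.≤ n × HasVertexCount P n

  LinearMap : ℕ → ℕ → Set
  LinearMap e d = Fin d → Point e

  apply : ∀ {e d} → LinearMap e d → Point e → Point d
  apply M y i = M i ∙ y

  record IsExtension {e d} (Q : Polytope e) (P : Polytope d) : Set where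
    field
      projection : LinearMap e d
      image      : ⟦ P ⟧ ≐ λ x → ∃[ y ] (y ∈ ⟦ Q ⟧ × apply projection y ≋ x)

  HasExtensionOfSize : ∀ {d} → Polytope d → Pred ℕ 0ℓ
  HasExtensionOfSize P k =
    ∃[ e ] Σ[ Q ∈ Polytope e ] (IsExtension Q P × HasFacetCount Q k)

  -- xc(P) = k
  HasExtensionComplexity : ∀ {d} → Polytope d → Pred ℕ 0ℓ
  HasExtensionComplexity P k =
    HasExtensionOfSize P k × (∀ {j} → HasExtensionOfSize P j → k ℕ.≤ j)

  InGrid : ℕ → ℕ → Pred (Point 2) 0ℓ
  InGrid a b x = ∃[ i ] ∃[ j ]
    ( (1 ℕ.≤ i × i ℕ.≤ a) × (1 ℕ.≤ j × j ℕ.≤ b)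
    × x Fin.zero ≈ fromℕ i × x (Fin.suc Fin.zero) ≈ fromℕ j)

-- The lower bound is a counting argument.  A vertex set X ⊆ [2n] on the
-- parabola makes (x − y)² − 1 ≥ 0 a valid inequality for every y ∉ X.  An
-- extension with k facets factors the matrix with entries (x − y)² − 1
-- (y ∉ X, x ∈ X) as U V with U, V ≥ 0 and inner dimension k, and after
-- rescaling U ≤ 1 and V = O(n²).  The rows (1, y, y², U_y) are spanned, with
-- coefficients in [−1, 1], by k + 3 of them.  These k + 3 rows, with U
-- rounded to multiples of 1/K for some K polynomial in n, determine X, so
-- at most n^O(k²) sets X belong to polygons of extension complexity ≤ k.
-- The 2ⁿ transversals of {1, 2}, {3, 4}, …, {2n − 1, 2n} thus include one
-- with 2ⁿ ≤ n^(36k²).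
module Submission where

open import Defs
open import Algebra.Bundles using (CommutativeRing; RawRing)
open import Algebra.Solver.Ring.AlmostCommutativeRing using (_-Raw-AlmostCommutative⟶_; fromCommutativeRing)
open import Axiom.ExcludedMiddle using (ExcludedMiddle)
open import Data.Bool.Base using (true)
open import Data.Fin.Base as Fin using (Fin; zero; suc)
import Data.Fin.Properties as Fin
open import Data.Fin.Subset as Subset using (Subset; _⊂_)
open import Data.Fin.Subset.Induction using (⊂-wellFounded; Acc; acc)
open import Data.Integer.Base as ℤ using (ℤ; +_; -[1+_])
import Data.Integer.Properties as ℤ
open import Data.Maybe.Base using (Maybe; map)
open import Data.Nat.Base as ℕ using (ℕ; zero; suc)
open import Data.Nat.Induction using (<-wellFounded)
import Data.Nat.Properties as ℕ
open import Data.Nat.Tactic.RingSolver using (solve-∀)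
open import Data.Product.Base using (Σ-syntax; ∃; ∃-syntax; _×_; _,_; proj₁; proj₂)
open import Data.Sum.Base using (_⊎_; inj₁; inj₂; [_,_]′)
open import Data.Vec.Base using (Vec; []; _∷_; lookup; tabulate)
open import Data.Vec.Properties using (lookup∘tabulate; lookup⇒[]=; []=⇒lookup)
open import Function.Definitions using (Injective)
open import Level using (0ℓ)
open import Relation.Binary.Bundles using (Poset)
open import Relation.Binary.Core using (Rel)
open import Relation.Binary.Definitions using (Symmetric; Tri; tri<; tri≈; tri>)
open import Relation.Binary.PropositionalEquality as ≡ using (_≡_)
open import Relation.Binary.Structures using (IsTotalOrder)
open import Relation.Nullary using (¬_; Dec; yes; no; does; contradiction)
open import Relation.Nullary.Decidable.Core using (dec⇒maybe)
open import Relation.Unary using (Pred; _∈_; _⊆_)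

-- Recording all n rows of U would allow n^O(nk) codes, too many to compare with the 2ⁿ polygons;
-- about k rows are affordable, so a few rows must control the others. V is not recorded at all:
-- when two polygons share a code, V is taken from the second. Suppose y is avoided by the first and
-- is a vertex of the second. The combination that produces row y, applied to the entries of the
-- second matrix in column y, gives (y - y)² - 1 = -1, whereas U_y times that column of V is
-- nonnegative. The gap of 1 exists because distinct integers have squared distance at least 1, and
-- it is what absorbs the rounding. Coefficients in [-1, 1], obtained from Cramer's rule at a
-- largest minor, keep the rounding errors from being amplified. Transversals always supply such a
-- y: what one of them rejects from a pair, a differing one chooses. The exponent 36k² bounds (2 +
-- 7k)(3 + k), and its square root 6k leads to c = 1/6.

-- Polynomial identities in commutative rings.

module RingSolver (R : CommutativeRing 0ℓ 0ℓ) where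
  open CommutativeRing R
  open import Algebra.Properties.Ring ring
  open import Algebra.Properties.AbelianGroup +-abelianGroup using (⁻¹-∙-comm)
  open import Algebra.Properties.CommutativeSemigroup +-commutativeSemigroup using (interchange)
  open import Algebra.Properties.Semiring.Mult.TCOptimised semiring
    using (×-homo-+; ×1-homo-*) renaming (_×_ to _×ᴺ_)
  open import Relation.Binary.Reasoning.Setoid setoid

  private
    -- The solver wants an equality test on coefficients, which ℤ has and an abstract ring has not.
    -- With this form of multiple, `fromℤ (+ 1)` computes to `1#`, so `con (+ 1)` matches a literal
    -- `1#`.
    fromℤ : ℤ → Carrier
    fromℤ (+ n)    = n ×ᴺ 1#
    fromℤ -[1+ n ] = - (suc n ×ᴺ 1#)

    ⊖-homo : ∀ m n → fromℤ (m ℤ.⊖ n) ≈ m ×ᴺ 1# - n ×ᴺ 1#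
    ⊖-homo m zero = begin
      m ×ᴺ 1#        ≈⟨ +-identityʳ _ ⟨
      m ×ᴺ 1# + 0#   ≈⟨ +-congˡ -0#≈0# ⟨
      m ×ᴺ 1# - 0#   ∎
    ⊖-homo zero (suc n) = sym (+-identityˡ _)
    ⊖-homo (suc m) (suc n) = begin
      fromℤ (suc m ℤ.⊖ suc n)               ≡⟨ ≡.cong fromℤ (ℤ.[1+m]⊖[1+n]≡m⊖n m n) ⟩
      fromℤ (m ℤ.⊖ n)                       ≈⟨ ⊖-homo m n ⟩
      m ×ᴺ 1# - n ×ᴺ 1#                     ≈⟨ +-identityˡ _ ⟨
      0# + (m ×ᴺ 1# - n ×ᴺ 1#)              ≈⟨ +-congʳ (-‿inverseʳ 1#) ⟨
      (1# - 1#) + (m ×ᴺ 1# - n ×ᴺ 1#)       ≈⟨ interchange _ _ _ _ ⟩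
      (1# + m ×ᴺ 1#) + (- 1# - n ×ᴺ 1#)     ≈⟨ +-congˡ (⁻¹-∙-comm _ _) ⟩
      (1# + m ×ᴺ 1#) - (1# + n ×ᴺ 1#)       ≈⟨ +-cong (×-homo-+ 1# 1 m) (-‿cong (×-homo-+ 1# 1 n)) ⟨
      suc m ×ᴺ 1# - suc n ×ᴺ 1#             ∎

    neg-homo : ∀ i → fromℤ (ℤ.- i) ≈ - fromℤ i
    neg-homo (+ zero)  = sym -0#≈0#
    neg-homo ℤ.+[1+ n ] = refl
    neg-homo -[1+ n ]  = sym (-‿involutive _)

    +-homo : ∀ i j → fromℤ (i ℤ.+ j) ≈ fromℤ i + fromℤ j
    +-homo (+ m)    (+ n)    = ×-homo-+ 1# m n
    +-homo (+ m)    -[1+ n ] = ⊖-homo m (suc n)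
    +-homo -[1+ m ] (+ n)    = trans (⊖-homo n (suc m)) (+-comm _ _)
    +-homo -[1+ m ] -[1+ n ] = begin
      - (suc (suc (m ℕ.+ n)) ×ᴺ 1#)      ≡⟨ ≡.cong (λ k → - (k ×ᴺ 1#)) (≡.sym (ℕ.+-suc (suc m) n)) ⟩
      - ((suc m ℕ.+ suc n) ×ᴺ 1#)        ≈⟨ -‿cong (×-homo-+ 1# (suc m) (suc n)) ⟩
      - (suc m ×ᴺ 1# + suc n ×ᴺ 1#)      ≈⟨ ⁻¹-∙-comm _ _ ⟨
      - (suc m ×ᴺ 1#) - suc n ×ᴺ 1#      ∎

    pos-*-homo : ∀ m j → fromℤ (+ m ℤ.* j) ≈ m ×ᴺ 1# * fromℤ j
    pos-*-homo m (+ n) = begin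
      fromℤ (+ m ℤ.* + n)          ≡⟨ ≡.cong fromℤ (≡.sym (ℤ.pos-* m n)) ⟩
      (m ℕ.* n) ×ᴺ 1#              ≈⟨ ×1-homo-* m n ⟩
      m ×ᴺ 1# * n ×ᴺ 1#            ∎
    pos-*-homo m -[1+ n ] = begin
      fromℤ (+ m ℤ.* -[1+ n ])           ≡⟨ ≡.cong fromℤ (≡.sym (ℤ.neg-distribʳ-* (+ m) (+ suc n))) ⟩
      fromℤ (ℤ.- (+ m ℤ.* + suc n))      ≈⟨ neg-homo (+ m ℤ.* + suc n) ⟩
      - fromℤ (+ m ℤ.* + suc n)          ≈⟨ -‿cong (pos-*-homo m (+ suc n)) ⟩
      - (m ×ᴺ 1# * suc n ×ᴺ 1#)          ≈⟨ -‿distribʳ-* _ _ ⟩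
      m ×ᴺ 1# * - (suc n ×ᴺ 1#)          ∎

    *-homo : ∀ i j → fromℤ (i ℤ.* j) ≈ fromℤ i * fromℤ j
    *-homo (+ m)    j = pos-*-homo m j
    *-homo -[1+ m ] j = begin
      fromℤ (-[1+ m ] ℤ.* j)           ≡⟨ ≡.cong fromℤ (≡.sym (ℤ.neg-distribˡ-* (+ suc m) j)) ⟩
      fromℤ (ℤ.- (+ suc m ℤ.* j))      ≈⟨ neg-homo (+ suc m ℤ.* j) ⟩
      - fromℤ (+ suc m ℤ.* j)          ≈⟨ -‿cong (pos-*-homo (suc m) j) ⟩
      - (suc m ×ᴺ 1# * fromℤ j)        ≈⟨ -‿distribˡ-* _ _ ⟩
      - (suc m ×ᴺ 1#) * fromℤ j        ∎

    ℤ-rawRing : RawRing 0ℓ 0ℓ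
    ℤ-rawRing = CommutativeRing.rawRing ℤ.+-*-commutativeRing

    morphism : ℤ-rawRing -Raw-AlmostCommutative⟶ fromCommutativeRing R
    morphism = record
      { ⟦_⟧    = fromℤ
      ; +-homo = +-homo
      ; *-homo = *-homo
      ; -‿homo = neg-homo
      ; 0-homo = refl
      ; 1-homo = refl
      }

    _coeff≟_ : ∀ i j → Maybe (fromℤ i ≈ fromℤ j)
    i coeff≟ j = map (λ i≡j → reflexive (≡.cong fromℤ i≡j)) (dec⇒maybe (i ℤ.≟ j))

  open import Algebra.Solver.Ring ℤ-rawRing (fromCommutativeRing R) morphism _coeff≟_ public
    using (solve; _:=_; _:+_; _:*_; _:-_; :-_; con)

-- Size of the code space.

module Arithmetic where
  open import Data.Nat.Base using (_+_; _*_; _^_; _≤_; _<_; z≤n; s≤s; NonZero)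
  open ℕ.≤-Reasoning

  n≤2^n : ∀ n → n ≤ 2 ^ n
  n≤2^n zero    = z≤n
  n≤2^n (suc n) = begin
    1 + n              ≤⟨ ℕ.+-mono-≤ (ℕ.m^n>0 2 n) (n≤2^n n) ⟩
    2 ^ n + 2 ^ n      ≡⟨ ≡.cong (λ t → 2 ^ n + t) (≡.sym (ℕ.+-identityʳ (2 ^ n))) ⟩
    2 ^ suc n          ∎

  2^-cancel-≤ : ∀ {p q} → 2 ^ p ≤ 2 ^ q → p ≤ q
  2^-cancel-≤ {p} {q} 2^p≤2^q = ℕ.≮⇒≥ λ q<p → ℕ.≤⇒≯ 2^p≤2^q (ℕ.^-monoʳ-< 2 (s≤s (s≤s z≤n)) q<p)

  -- This is 2(2n)², from (x - y)² ≤ x² + y² for x and y in [2n].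
  slackBound : ℕ → ℕ
  slackBound n = (n * 2) * (n * 2) + (n * 2) * (n * 2)

  -- The scale K. Scaled errors of at most 1 in k entries, against entries of V of at most
  -- `slackBound n`, over 3 + k rows with coefficients in [-1, 1], add up to at most K - 1, just
  -- short of the scaled gap K.
  resolution : ℕ → ℕ → ℕ
  resolution n k = suc ((3 + k) * (k * slackBound n))

  -- For each of the 3 + k spanning rows: an element of [2n] and k rounded entries from 0, ..., K.
  codeBound : ℕ → ℕ → ℕ
  codeBound n k = ((n * 2) * suc (resolution n k) ^ k) ^ (3 + k)

  module _ {n : ℕ} .{{_ : NonZero n}} (3≤n : 3 ≤ n) where

    -- For k ≥ n nothing has to be counted. With this case settled, K can be bounded by a power of n
    -- alone.
    small : ∀ {k} → 1 ≤ k → n ≤ k → 2 ^ n ≤ n ^ (36 * (k * k))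
    small {k} 1≤k n≤k = begin
      2 ^ n                  ≤⟨ ℕ.^-monoˡ-≤ n (ℕ.≤-trans (s≤s (s≤s z≤n)) 3≤n) ⟩
      n ^ n                  ≤⟨ ℕ.^-monoʳ-≤ n n≤36kk ⟩
      n ^ (36 * (k * k))     ∎
      where
      n≤36kk : n ≤ 36 * (k * k)
      n≤36kk = begin
        n                ≤⟨ n≤k ⟩
        k                ≡⟨ ≡.sym (ℕ.*-identityʳ k) ⟩
        k * 1            ≤⟨ ℕ.*-monoʳ-≤ k 1≤k ⟩
        k * k            ≤⟨ ℕ.m≤m+n (k * k) (35 * (k * k)) ⟩
        36 * (k * k)     ∎

    -- For k ≤ n the left side is at most 18n⁴, and 18 ≤ 27 ≤ n³.
    resolution≤ : ∀ {k} → k ≤ n → suc (resolution n k) ≤ n ^ 7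
    resolution≤ {k} k≤n = begin
      2 + (3 + k) * (k * ((n * 2) * (n * 2) + (n * 2) * (n * 2)))
        ≤⟨ ℕ.+-mono-≤ 2≤2n⁴ (ℕ.*-mono-≤ (ℕ.+-mono-≤ 3≤n k≤n) (ℕ.*-monoˡ-≤ ((n * 2) * (n * 2) + (n * 2) * (n * 2)) k≤n)) ⟩
      2 * (n * (n * (n * n))) + (n + n) * (n * ((n * 2) * (n * 2) + (n * 2) * (n * 2)))
        ≡⟨ collect n ⟩
      18 * (n * (n * (n * n)))
        ≤⟨ ℕ.*-monoˡ-≤ (n * (n * (n * n))) (ℕ.≤-trans (ℕ.m≤m+n 18 9) (ℕ.*-mono-≤ 3≤n (ℕ.*-mono-≤ 3≤n 3≤n))) ⟩
      n * (n * n) * (n * (n * (n * n)))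
        ≡⟨ power n ⟩
      n ^ 7 ∎
      where
      1≤n : 1 ≤ n
      1≤n = ℕ.≤-trans (s≤s z≤n) 3≤n
      2≤2n⁴ : 2 ≤ 2 * (n * (n * (n * n)))
      2≤2n⁴ = ℕ.*-monoʳ-≤ 2 (ℕ.*-mono-≤ 1≤n (ℕ.*-mono-≤ 1≤n (ℕ.*-mono-≤ 1≤n 1≤n)))
      collect : ∀ n → 2 * (n * (n * (n * n))) + (n + n) * (n * ((n * 2) * (n * 2) + (n * 2) * (n * 2)))
                      ≡ 18 * (n * (n * (n * n)))
      collect = solve-∀
      power : ∀ n → n * (n * n) * (n * (n * (n * n))) ≡ n * (n * (n * (n * (n * (n * (n * 1))))))
      power = solve-∀

    -- As 2n ≤ n², the exponent of n becomes (2 + 7k)(3 + k), which for k ≥ 1 is at most 9k · 4k.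
    large : ∀ {k R} → 1 ≤ k → R ≤ n ^ 7 → ((n * 2) * R ^ k) ^ (3 + k) ≤ n ^ (36 * (k * k))
    large {k} {R} 1≤k R≤n⁷ = begin
      ((n * 2) * R ^ k) ^ (3 + k)           ≤⟨ ℕ.^-monoˡ-≤ (3 + k) (ℕ.*-mono-≤ 2n≤n² (ℕ.^-monoˡ-≤ k R≤n⁷)) ⟩
      (n ^ 2 * (n ^ 7) ^ k) ^ (3 + k)       ≡⟨ ≡.cong (λ t → (n ^ 2 * t) ^ (3 + k)) (ℕ.^-*-assoc n 7 k) ⟩
      (n ^ 2 * n ^ (7 * k)) ^ (3 + k)       ≡⟨ ≡.cong (_^ (3 + k)) (≡.sym (ℕ.^-distribˡ-+-* n 2 (7 * k))) ⟩
      (n ^ (2 + 7 * k)) ^ (3 + k)           ≡⟨ ℕ.^-*-assoc n (2 + 7 * k) (3 + k) ⟩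
      n ^ ((2 + 7 * k) * (3 + k))           ≤⟨ ℕ.^-monoʳ-≤ n exponent ⟩
      n ^ (36 * (k * k))                    ∎
      where
      2n≤n² : n * 2 ≤ n ^ 2
      2n≤n² = ℕ.*-monoʳ-≤ n (ℕ.≤-trans (ℕ.≤-trans (s≤s (s≤s z≤n)) 3≤n) (ℕ.≤-reflexive (≡.sym (ℕ.*-identityʳ n))))
      collect : ∀ k → (2 * k + 7 * k) * (3 * k + k) ≡ 36 * (k * k)
      collect = solve-∀
      exponent : (2 + 7 * k) * (3 + k) ≤ 36 * (k * k)
      exponent = begin
        (2 + 7 * k) * (3 + k)              ≤⟨ ℕ.*-mono-≤ (ℕ.+-monoˡ-≤ (7 * k) (ℕ.*-monoʳ-≤ 2 1≤k)) (ℕ.+-monoˡ-≤ k (ℕ.*-monoʳ-≤ 3 1≤k)) ⟩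
        (2 * k + 7 * k) * (3 * k + k)      ≡⟨ collect k ⟩
        36 * (k * k)                       ∎

    codeBound⇒exponentialBound : ∀ {k} → 1 ≤ k → 2 ^ n ≤ codeBound n k → 2 ^ n ≤ n ^ (36 * (k * k))
    codeBound⇒exponentialBound {k} 1≤k 2^n≤ = [ small 1≤k , (λ k≤n → ℕ.≤-trans 2^n≤ (large 1≤k (resolution≤ k≤n))) ]′ (ℕ.≤-total n k)

-- Ordered field arithmetic, finite sums and maxima.

module OrderedField (em : ExcludedMiddle 0ℓ) (ℝ : CompleteOrderedField) where
  open CompleteOrderedField ℝ hiding (zero) public
  open IsTotalOrder isTotalOrder public
    using (isPartialOrder)
    renaming ( refl to ≤-refl; reflexive to ≤-reflexive; trans to ≤-trans
             ; antisym to ≤-antisym; total to ≤-total )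
  open RingSolver commutativeRing public
  open import Algebra.Properties.Ring ring public using (-0#≈0#; -‿involutive; x[y-z]≈xy-xz)
  open import Algebra.Properties.Semiring.Mult semiring using (×-homo-+; ×1-homo-*)
  open import Algebra.Properties.Semiring.Sum semiring public
    using (sum; ∑-distrib-+; ∑-comm; *-distribˡ-sum; *-distribʳ-sum; sum-replicate-zero)
  open import Algebra.Properties.Semiring.Sum semiring using (sum-cong-≋)

  poset : Poset 0ℓ 0ℓ 0ℓ
  poset = record { isPartialOrder = isPartialOrder }

  open import Relation.Binary.Reasoning.PartialOrder poset public

  ≤-resp-≈ : ∀ {a b c d} → a ≈ c → b ≈ d → a ≤ b → c ≤ d
  ≤-resp-≈ a≈c b≈d a≤b = ≤-trans (≤-reflexive (sym a≈c)) (≤-trans a≤b (≤-reflexive b≈d))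

  0≤y-x : ∀ {x y} → x ≤ y → 0# ≤ y - x
  0≤y-x {x} x≤y = ≤-trans (≤-reflexive (sym (-‿inverseʳ x))) (+-monoˡ-≤ (- x) x≤y)

  0≤y-x⇒x≤y : ∀ {x y} → 0# ≤ y - x → x ≤ y
  0≤y-x⇒x≤y {x} {y} p = ≤-resp-≈ (+-identityˡ x) (solve 2 (λ x y → y :- x :+ x := y) refl x y) (+-monoˡ-≤ x p)

  +-monoʳ-≤ : ∀ z {x y} → x ≤ y → z + x ≤ z + y
  +-monoʳ-≤ z {x} {y} p = ≤-resp-≈ (+-comm x z) (+-comm y z) (+-monoˡ-≤ z p)

  +-mono-≤ : ∀ {a b c d} → a ≤ b → c ≤ d → a + c ≤ b + d
  +-mono-≤ {b = b} {c} p q = ≤-trans (+-monoˡ-≤ c p) (+-monoʳ-≤ b q)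

  +-nonNeg : ∀ {x y} → 0# ≤ x → 0# ≤ y → 0# ≤ x + y
  +-nonNeg p q = ≤-trans (≤-reflexive (sym (+-identityˡ 0#))) (+-mono-≤ p q)

  neg-antimono-≤ : ∀ {x y} → x ≤ y → - y ≤ - x
  neg-antimono-≤ {x} {y} p = 0≤y-x⇒x≤y
    (≤-trans (0≤y-x p) (≤-reflexive (solve 2 (λ x y → y :- x := :- x :- (:- y)) refl x y)))

  x≤0⇒0≤-x : ∀ {x} → x ≤ 0# → 0# ≤ - x
  x≤0⇒0≤-x p = ≤-trans (≤-reflexive (sym -0#≈0#)) (neg-antimono-≤ p)

  x≤x+y : ∀ {x y} → 0# ≤ y → x ≤ x + y
  x≤x+y {x} p = ≤-trans (≤-reflexive (sym (+-identityʳ x))) (+-monoʳ-≤ x p)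

  *-monoˡ-≤ : ∀ {z x y} → 0# ≤ z → x ≤ y → z * x ≤ z * y
  *-monoˡ-≤ {z} {x} {y} 0≤z p = 0≤y-x⇒x≤y
    (≤-trans (*-nonNeg 0≤z (0≤y-x p)) (≤-reflexive (x[y-z]≈xy-xz z y x)))

  *-mono-≤ : ∀ {a b c d} → 0# ≤ a → 0# ≤ d → a ≤ b → c ≤ d → a * c ≤ b * d
  *-mono-≤ {a} {b} {c} {d} 0≤a 0≤d a≤b c≤d = ≤-trans (*-monoˡ-≤ 0≤a c≤d)
    (≤-resp-≈ (*-comm d a) (*-comm d b) (*-monoˡ-≤ 0≤d a≤b))

  square-nonNeg : ∀ x → 0# ≤ x * x
  square-nonNeg x with ≤-total 0# x
  ... | inj₁ p = *-nonNeg p p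
  ... | inj₂ p = ≤-trans (*-nonNeg (x≤0⇒0≤-x p) (x≤0⇒0≤-x p))
                         (≤-reflexive (solve 1 (λ x → (:- x) :* (:- x) := x :* x) refl x))

  0≤1 : 0# ≤ 1#
  0≤1 = ≤-trans (square-nonNeg 1#) (≤-reflexive (*-identityʳ 1#))

  1≰0 : ¬ 1# ≤ 0#
  1≰0 p = 0≉1 (≤-antisym 0≤1 p)

  *-cancelˡ-≈0 : ∀ {x y} → ¬ x ≈ 0# → x * y ≈ 0# → y ≈ 0#
  *-cancelˡ-≈0 {x} {y} x≉0 xy≈0 = begin-equality
    y                 ≈⟨ *-identityˡ y ⟨
    1# * y            ≈⟨ *-congʳ (*-inverseʳ x≉0) ⟨
    x * x ⁻¹ * y      ≈⟨ solve 3 (λ x i y → x :* i :* y := i :* (x :* y)) refl x (x ⁻¹) y ⟩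
    x ⁻¹ * (x * y)    ≈⟨ *-congˡ xy≈0 ⟩
    x ⁻¹ * 0#         ≈⟨ zeroʳ _ ⟩
    0#                ∎

  square≈0 : ∀ {x} → x * x ≈ 0# → x ≈ 0#
  square≈0 {x} xx≈0 with em {x ≈ 0#}
  ... | yes x≈0 = x≈0
  ... | no  x≉0 = *-cancelˡ-≈0 x≉0 xx≈0

  ⁻¹-nonNeg : ∀ {x} → 0# ≤ x → ¬ x ≈ 0# → 0# ≤ x ⁻¹
  ⁻¹-nonNeg {x} 0≤x x≉0 with ≤-total 0# (x ⁻¹)
  ... | inj₁ p = p
  ... | inj₂ p = contradiction
    (begin
      1#                  ≈⟨ *-inverseʳ x≉0 ⟨
      x * x ⁻¹            ≤⟨ *-monoˡ-≤ 0≤x p ⟩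
      x * 0#              ≈⟨ zeroʳ x ⟩
      0#                  ∎)
    1≰0

  *-cancelˡ-≤ : ∀ {z x y} → 0# ≤ z → ¬ z ≈ 0# → z * x ≤ z * y → x ≤ y
  *-cancelˡ-≤ {z} {x} {y} 0≤z z≉0 p = ≤-resp-≈ (cancel x) (cancel y) (*-monoˡ-≤ (⁻¹-nonNeg 0≤z z≉0) p)
    where
    cancel : ∀ w → z ⁻¹ * (z * w) ≈ w
    cancel w = begin-equality
      z ⁻¹ * (z * w)  ≈⟨ solve 3 (λ z i w → i :* (z :* w) := z :* i :* w) refl z (z ⁻¹) w ⟩
      z * z ⁻¹ * w    ≈⟨ *-congʳ (*-inverseʳ z≉0) ⟩
      1# * w          ≈⟨ *-identityˡ w ⟩
      w               ∎

  -- If y ≤ x, then d = x - y satisfies d² ≤ d² + 2yd = x² - y² ≤ 0, so d vanishes.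
  square-cancel-≤ : ∀ {x y} → 0# ≤ y → x * x ≤ y * y → x ≤ y
  square-cancel-≤ {x} {y} 0≤y xx≤yy with ≤-total x y
  ... | inj₁ x≤y = x≤y
  ... | inj₂ y≤x = 0≤y-x⇒x≤y (≤-trans (x≤0⇒0≤-x (≤-reflexive x-y≈0))
                                   (≤-reflexive (solve 2 (λ x y → :- (x :- y) := y :- x) refl x y)))
    where
    d = x - y
    0≤d : 0# ≤ d
    0≤d = 0≤y-x y≤x
    dd≤0 : d * d ≤ 0#
    dd≤0 = begin
      d * d                      ≤⟨ x≤x+y (+-nonNeg (*-nonNeg 0≤y 0≤d) (*-nonNeg 0≤y 0≤d)) ⟩
      d * d + (y * d + y * d)    ≈⟨ solve 2 (λ x y → (x :- y) :* (x :- y) :+ (y :* (x :- y) :+ y :* (x :- y))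
                                                    := x :* x :- y :* y) refl x y ⟩
      x * x - y * y              ≤⟨ +-monoˡ-≤ _ xx≤yy ⟩
      y * y - y * y              ≈⟨ -‿inverseʳ _ ⟩
      0#                         ∎
    x-y≈0 : d ≈ 0#
    x-y≈0 = square≈0 (≤-antisym dd≤0 (square-nonNeg d))

  fromℕ-+ : ∀ m n → fromℕ (m ℕ.+ n) ≈ fromℕ m + fromℕ n
  fromℕ-+ m n = ×-homo-+ 1# m n

  fromℕ-* : ∀ m n → fromℕ (m ℕ.* n) ≈ fromℕ m * fromℕ n
  fromℕ-* m n = ×1-homo-* m n

  fromℕ-1 : fromℕ 1 ≈ 1#
  fromℕ-1 = +-identityʳ 1#

  fromℕ-nonNeg : ∀ n → 0# ≤ fromℕ n
  fromℕ-nonNeg zero    = ≤-refl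
  fromℕ-nonNeg (suc n) = +-nonNeg 0≤1 (fromℕ-nonNeg n)

  fromℕ-mono : ∀ {m n} → m ℕ.≤ n → fromℕ m ≤ fromℕ n
  fromℕ-mono {n = n} ℕ.z≤n = fromℕ-nonNeg n
  fromℕ-mono (ℕ.s≤s m≤n) = +-monoʳ-≤ 1# (fromℕ-mono m≤n)

  fromℕ-suc≰0 : ∀ n → ¬ fromℕ (suc n) ≤ 0#
  fromℕ-suc≰0 n p = 1≰0 (≤-trans (x≤x+y (fromℕ-nonNeg n)) p)

  fromℕ≉0 : ∀ {n} → 1 ℕ.≤ n → ¬ fromℕ n ≈ 0#
  fromℕ≉0 {suc n} _ p = fromℕ-suc≰0 n (≤-reflexive p)

  fromℕ-cancel-≤ : ∀ {m n} → fromℕ m ≤ fromℕ n → m ℕ.≤ n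
  fromℕ-cancel-≤ {zero}          p = ℕ.z≤n
  fromℕ-cancel-≤ {suc m} {zero}  p = contradiction p (fromℕ-suc≰0 m)
  fromℕ-cancel-≤ {suc m} {suc n} p = ℕ.s≤s (fromℕ-cancel-≤
    (≤-resp-≈ (drop m) (drop n) (+-monoʳ-≤ (- 1#) p)))
    where
    drop : ∀ k → - 1# + fromℕ (suc k) ≈ fromℕ k
    drop k = solve 2 (λ o x → :- o :+ (o :+ x) := x) refl 1# (fromℕ k)

  fromℕ-injective : ∀ {m n} → fromℕ m ≈ fromℕ n → m ≡ n
  fromℕ-injective p = ℕ.≤-antisym (fromℕ-cancel-≤ (≤-reflexive p)) (fromℕ-cancel-≤ (≤-reflexive (sym p)))

  sum-nonNeg : ∀ {n} {f : Fin n → Carrier} → (∀ i → 0# ≤ f i) → 0# ≤ sum f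
  sum-nonNeg {zero}  p = ≤-refl
  sum-nonNeg {suc n} p = +-nonNeg (p zero) (sum-nonNeg (λ i → p (suc i)))

  sum-mono-≤ : ∀ {n} {f g : Fin n → Carrier} → (∀ i → f i ≤ g i) → sum f ≤ sum g
  sum-mono-≤ {zero}  p = ≤-refl
  sum-mono-≤ {suc n} p = +-mono-≤ (p zero) (sum-mono-≤ (λ i → p (suc i)))

  sum-≤-const : ∀ {n} {f : Fin n → Carrier} b → (∀ i → f i ≤ b) → sum f ≤ fromℕ n * b
  sum-≤-const {zero}      b p = ≤-reflexive (sym (zeroˡ b))
  sum-≤-const {suc n} {f} b p = begin
    f zero + sum (λ i → f (suc i))    ≤⟨ +-mono-≤ (p zero) (sum-≤-const b (λ i → p (suc i))) ⟩
    b + fromℕ n * b                   ≈⟨ +-congʳ (*-identityˡ b) ⟨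
    1# * b + fromℕ n * b              ≈⟨ distribʳ b 1# (fromℕ n) ⟨
    fromℕ (suc n) * b                 ∎

  sum-cong : ∀ {n} {f g : Fin n → Carrier} → (∀ i → f i ≈ g i) → sum f ≈ sum g
  sum-cong p = sum-cong-≋ p

  sum-zero : ∀ {n} {f : Fin n → Carrier} → (∀ i → f i ≈ 0#) → sum f ≈ 0#
  sum-zero {n} p = trans (sum-cong p) (sum-replicate-zero n)

  term≤sum : ∀ {n} {f : Fin n → Carrier} → (∀ i → 0# ≤ f i) → ∀ i → f i ≤ sum f
  term≤sum {suc n} p zero    = x≤x+y (sum-nonNeg (λ i → p (suc i)))
  term≤sum {suc n} {f} p (suc i) = begin
    f (suc i)                         ≤⟨ term≤sum (λ j → p (suc j)) i ⟩
    sum (λ j → f (suc j))             ≤⟨ x≤x+y (p zero) ⟩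
    sum (λ j → f (suc j)) + f zero    ≈⟨ +-comm _ _ ⟩
    sum f                             ∎

  sum≈0⇒term≈0 : ∀ {n} {f : Fin n → Carrier} → (∀ i → 0# ≤ f i) → sum f ≈ 0# → ∀ i → f i ≈ 0#
  sum≈0⇒term≈0 p s≈0 i = ≤-antisym (≤-trans (term≤sum p i) (≤-reflexive s≈0)) (p i)

  sum-single : ∀ {n} {f : Fin n → Carrier} i → (∀ j → ¬ j ≡ i → f j ≈ 0#) → sum f ≈ f i
  sum-single {suc n} {f} zero    p =
    trans (+-congˡ (sum-zero (λ j → p (suc j) (λ ())))) (+-identityʳ _)
  sum-single {suc n} {f} (suc i) p = trans
    (+-cong (p zero (λ ())) (sum-single i (λ j j≢i → p (suc j) (λ { ≡.refl → j≢i ≡.refl }))))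
    (+-identityˡ _)

  sum-neg : ∀ {n} (f : Fin n → Carrier) → sum (λ i → - f i) ≈ - sum f
  sum-neg {zero}  f = sym -0#≈0#
  sum-neg {suc n} f = trans (+-congˡ (sum-neg (λ i → f (suc i))))
    (solve 2 (λ x y → :- x :+ :- y := :- (x :+ y)) refl (f zero) _)

  sum-sub : ∀ {n} (f g : Fin n → Carrier) → sum (λ i → f i - g i) ≈ sum f - sum g
  sum-sub f g = trans (∑-distrib-+ f (λ i → - g i)) (+-congˡ (sum-neg g))

  argmax : ∀ {n} (f : Fin (suc n) → Carrier) → ∃[ i ] (∀ j → f j ≤ f i)
  argmax {zero}  f = zero , λ { zero → ≤-refl }
  argmax {suc n} f with argmax (λ i → f (suc i))
  ... | i , p with ≤-total (f zero) (f (suc i))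
  ...   | inj₁ q = suc i , λ { zero → q ; (suc j) → p j }
  ...   | inj₂ q = zero , λ { zero → ≤-refl ; (suc j) → ≤-trans (p j) q }

  infix 4 _≤∣_∣

  _≤∣_∣ : Carrier → Carrier → Set
  x ≤∣ b ∣ = - b ≤ x × x ≤ b

  neg-≤∣∣ : ∀ {x b} → x ≤∣ b ∣ → - x ≤∣ b ∣
  neg-≤∣∣ {b = b} (p , q) = neg-antimono-≤ q , ≤-trans (neg-antimono-≤ p) (≤-reflexive (-‿involutive b))

  *-≤∣∣ : ∀ {a x b} → 0# ≤ a → x ≤∣ b ∣ → a * x ≤∣ a * b ∣
  *-≤∣∣ {a} {x} {b} 0≤a (p , q) =
    ≤-trans (≤-reflexive (solve 2 (λ a b → :- (a :* b) := a :* :- b) refl a b)) (*-monoˡ-≤ 0≤a p) ,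
    *-monoˡ-≤ 0≤a q

  ≤∣∣-resp : ∀ {x y a b} → x ≈ y → a ≈ b → x ≤∣ a ∣ → y ≤∣ b ∣
  ≤∣∣-resp x≈y a≈b (p , q) = ≤-resp-≈ (-‿cong a≈b) x≈y p , ≤-resp-≈ x≈y a≈b q

  abs : ∀ x → ∃[ m ] (0# ≤ m × x ≤∣ m ∣ × (m ≈ x ⊎ m ≈ - x))
  abs x with ≤-total 0# x
  ... | inj₁ p = x , p , (≤-trans (≤-trans (neg-antimono-≤ p) (≤-reflexive -0#≈0#)) p , ≤-refl) , inj₁ refl
  ... | inj₂ p = - x , x≤0⇒0≤-x p ,
    (≤-reflexive (-‿involutive x) , ≤-trans p (x≤0⇒0≤-x p)) , inj₂ refl

-- Exterior products as a calculus of minors.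

module Wedge (em : ExcludedMiddle 0ℓ) (ℝ : CompleteOrderedField) (I : Set) where
  open OrderedField em ℝ

  -- Any function on r-tuples; alternation is not demanded. With `I` the rows of a matrix and its
  -- columns as functions on `I`, wedging r columns onto the constant 1 yields the r × r minors.
  Form : ℕ → Set
  Form r = Vec I r → Carrier

  -- The exterior product ℓ ∧ ω, expanded along its first argument.
  wedge : ∀ {r} → (I → Carrier) → Form r → Form (suc r)
  wedge {zero}  ℓ ω (v ∷ []) = ℓ v * ω []
  wedge {suc r} ℓ ω (v ∷ w)  = ℓ v * ω w - wedge ℓ (λ u → ω (v ∷ u)) w

  wedge-zero : ∀ {r} ℓ {ω : Form r} → (∀ w → ω w ≈ 0#) → ∀ w → wedge ℓ ω w ≈ 0#
  wedge-zero {zero}  ℓ p (v ∷ []) = trans (*-congˡ (p [])) (zeroʳ _)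
  wedge-zero {suc r} ℓ {ω} p (v ∷ w) = begin-equality
    ℓ v * ω w - wedge ℓ (λ u → ω (v ∷ u)) w  ≈⟨ +-cong (*-congˡ (p w)) (-‿cong (wedge-zero ℓ (λ u → p (v ∷ u)) w)) ⟩
    ℓ v * 0# - 0#                            ≈⟨ solve 1 (λ x → x :* con (+ 0) :- con (+ 0) := con (+ 0)) refl (ℓ v) ⟩
    0#                                       ∎

  wedge-linear : ∀ {r} ℓ a (ω η : Form r) w →
                 wedge ℓ (λ u → a * ω u - η u) w ≈ a * wedge ℓ ω w - wedge ℓ η w
  wedge-linear {zero} ℓ a ω η (v ∷ []) =
    solve 4 (λ l a x y → l :* (a :* x :- y) := a :* (l :* x) :- l :* y) refl (ℓ v) a (ω []) (η [])
  wedge-linear {suc r} ℓ a ω η (v ∷ w) = trans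
    (+-congˡ (-‿cong (wedge-linear ℓ a (λ u → ω (v ∷ u)) (λ u → η (v ∷ u)) w)))
    (solve 6 (λ l a x y p q → l :* (a :* x :- y) :- (a :* p :- q) := a :* (l :* x :- p) :- (l :* y :- q))
      refl (ℓ v) a (ω w) (η w) _ _)

  -- Expanding at the first tuple entry `v` leaves terms in `ℓ v` and `m v`, which match up to sign,
  -- and the same claim for `ω` contracted with `v`.
  wedge-anticomm : ∀ {r} ℓ m (ω : Form r) w →
                   wedge ℓ (wedge m ω) w ≈ - wedge m (wedge ℓ ω) w
  wedge-anticomm {zero} ℓ m ω (v ∷ u ∷ []) =
    solve 5 (λ a b c d x → a :* (d :* x) :- b :* (c :* x) := :- (c :* (b :* x) :- d :* (a :* x)))
      refl (ℓ v) (ℓ u) (m v) (m u) (ω [])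
  wedge-anticomm {suc r} ℓ m ω (v ∷ w) = begin-equality
    ℓ v * wedge m ω w - wedge ℓ (λ u → m v * ω u - wedge m (ι ω) u) w
      ≈⟨ +-congˡ (-‿cong (wedge-linear ℓ (m v) ω (wedge m (ι ω)) w)) ⟩
    ℓ v * wedge m ω w - (m v * wedge ℓ ω w - wedge ℓ (wedge m (ι ω)) w)
      ≈⟨ +-congˡ (-‿cong (+-congˡ (-‿cong (wedge-anticomm ℓ m (ι ω) w)))) ⟩
    ℓ v * wedge m ω w - (m v * wedge ℓ ω w - - wedge m (wedge ℓ (ι ω)) w)
      ≈⟨ solve 5 (λ a b c d x → a :* c :- (b :* d :- (:- x)) := :- (b :* d :- (a :* c :- x))) refl _ _ _ _ _ ⟩
    - (m v * wedge ℓ ω w - (ℓ v * wedge m ω w - wedge m (wedge ℓ (ι ω)) w))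
      ≈⟨ -‿cong (+-congˡ (-‿cong (wedge-linear m (ℓ v) ω (wedge ℓ (ι ω)) w))) ⟨
    - (m v * wedge ℓ ω w - wedge m (λ u → ℓ v * ω u - wedge ℓ (ι ω) u) w)
      ∎
    where
    ι : ∀ {r} → Form (suc r) → Form r
    ι ω u = ω (v ∷ u)

  -- Anticommutativity would only show that twice the value vanishes; the same induction avoids
  -- dividing by 2.
  wedge-self : ∀ {r} ℓ (ω : Form r) w → wedge ℓ (wedge ℓ ω) w ≈ 0#
  wedge-self {zero} ℓ ω (v ∷ u ∷ []) =
    solve 3 (λ a b x → a :* (b :* x) :- b :* (a :* x) := con (+ 0)) refl (ℓ v) (ℓ u) (ω [])
  wedge-self {suc r} ℓ ω (v ∷ w) = begin-equality
    ℓ v * wedge ℓ ω w - wedge ℓ (λ u → ℓ v * ω u - wedge ℓ (ι ω) u) w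
      ≈⟨ +-congˡ (-‿cong (wedge-linear ℓ (ℓ v) ω (wedge ℓ (ι ω)) w)) ⟩
    ℓ v * wedge ℓ ω w - (ℓ v * wedge ℓ ω w - wedge ℓ (wedge ℓ (ι ω)) w)
      ≈⟨ +-congˡ (-‿cong (+-congˡ (-‿cong (wedge-self ℓ (ι ω) w)))) ⟩
    ℓ v * wedge ℓ ω w - (ℓ v * wedge ℓ ω w - 0#)
      ≈⟨ solve 1 (λ x → x :- (x :- con (+ 0)) := con (+ 0)) refl _ ⟩
    0# ∎
    where
    ι : ∀ {r} → Form (suc r) → Form r
    ι ω u = ω (v ∷ u)

  -- Laplace expansion: at a fixed tuple the value is linear in `ℓ`, and its coefficients are values
  -- of `ω` up to sign.
  wedge-expand : ∀ {r} (ω : Form r) B → (∀ w → ω w ≤∣ B ∣) → (w : Vec I (suc r)) →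
    Σ[ c ∈ (Fin (suc r) → Carrier) ] ((∀ j → c j ≤∣ B ∣) × (∀ ℓ → wedge ℓ ω w ≈ sum (λ j → c j * ℓ (lookup w j))))
  wedge-expand {zero}  ω B bd (v ∷ []) =
    (λ _ → ω []) , (λ _ → bd []) , λ ℓ → trans (*-comm _ _) (sym (+-identityʳ _))
  wedge-expand {suc r} ω B bd (v ∷ w) with wedge-expand (λ u → ω (v ∷ u)) B (λ u → bd (v ∷ u)) w
  ... | c , c-bd , exp = c′ , c′-bd , λ ℓ → +-cong (*-comm _ _) (trans (-‿cong (exp ℓ)) (neg-sum ℓ))
    where
    c′ : Fin (suc (suc r)) → Carrier
    c′ zero    = ω w
    c′ (suc j) = - c j
    c′-bd : ∀ j → c′ j ≤∣ B ∣
    c′-bd zero    = bd w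
    c′-bd (suc j) = neg-≤∣∣ (c-bd j)
    neg-sum : ∀ ℓ → - sum (λ j → c j * ℓ (lookup w j)) ≈ sum (λ j → - c j * ℓ (lookup w j))
    neg-sum ℓ = trans (sym (sum-neg (λ j → c j * ℓ (lookup w j)))) (sum-cong (λ j →
      solve 2 (λ x y → :- (x :* y) := :- x :* y) refl (c j) (ℓ (lookup w j))))

-- Spanning rows with coefficients in [-1, 1].

module Spanner (em : ExcludedMiddle 0ℓ) (ℝ : CompleteOrderedField) where
  open OrderedField em ℝ

  module _ {n : ℕ} where
    open Wedge em ℝ (Fin (suc n))

    -- Greedy choice of a column basis: a column is wedged on exactly when the product stays nonzero
    -- somewhere. The values of `ω` are then minors of maximal order, and wedging on any further
    -- column gives zero.
    nondegenerateForm : ∀ {d} (ℓ : Fin d → Fin (suc n) → Carrier) →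
      ∃[ r ] (r ℕ.≤ d × Σ[ ω ∈ Form r ]
        ((∃[ w ] ¬ ω w ≈ 0#) × (∀ i w → wedge (ℓ i) ω w ≈ 0#)))
    nondegenerateForm {zero} ℓ = 0 , ℕ.z≤n , (λ _ → 1#) , ([] , λ p → 0≉1 (sym p)) , λ ()
    nondegenerateForm {suc d} ℓ with nondegenerateForm (λ i → ℓ (suc i))
    ... | r , r≤d , ω , nz , z with em {∃[ w ] ¬ wedge (ℓ zero) ω w ≈ 0#}
    ...   | yes nz′ = suc r , ℕ.s≤s r≤d , wedge (ℓ zero) ω , nz′ , z′
      where
      z′ : ∀ i w → wedge (ℓ i) (wedge (ℓ zero) ω) w ≈ 0#
      z′ zero    w = wedge-self (ℓ zero) ω w
      z′ (suc i) w = begin-equality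
        wedge (ℓ (suc i)) (wedge (ℓ zero) ω) w    ≈⟨ wedge-anticomm (ℓ (suc i)) (ℓ zero) ω w ⟩
        - wedge (ℓ zero) (wedge (ℓ (suc i)) ω) w  ≈⟨ -‿cong (wedge-zero (ℓ zero) (z i) w) ⟩
        - 0#                                      ≈⟨ -0#≈0# ⟩
        0#                                        ∎
    ...   | no ¬nz′ = r , ℕ.m≤n⇒m≤1+n r≤d , ω , nz , z′
      where
      z′ : ∀ i w → wedge (ℓ i) ω w ≈ 0#
      z′ zero w with em {wedge (ℓ zero) ω w ≈ 0#}
      ... | yes p = p
      ... | no ¬p = contradiction (w , ¬p) ¬nz′
      z′ (suc i) w = z i w

    argmaxForm : ∀ {r} (ω : Form r) → ∃[ w ] (∀ w′ → ω w′ ≤ ω w)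
    argmaxForm {zero}  ω = [] , λ { [] → ≤-refl }
    argmaxForm {suc r} ω with argmax (λ v → ω (v ∷ proj₁ (argmaxForm (λ w → ω (v ∷ w)))))
    ... | v , p = v ∷ proj₁ (argmaxForm (λ w → ω (v ∷ w))) ,
                  λ { (v′ ∷ w′) → ≤-trans (proj₂ (argmaxForm (λ w → ω (v′ ∷ w))) w′) (p v′) }

    argmaxAbs : ∀ {r} (ω : Form r) → ∃[ w ] ∃[ m ]
      (0# ≤ m × (m ≈ ω w ⊎ m ≈ - ω w) × (∀ w′ → ω w′ ≤∣ m ∣))
    argmaxAbs ω with argmaxForm (λ w → proj₁ (abs (ω w)))
    ... | w , p with abs (ω w)
    ...   | m , 0≤m , _ , m≈±ω = w , m , 0≤m , m≈±ω , λ w′ →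
      let _ , _ , (lower , upper) , _ = abs (ω w′)
      in ≤-trans (neg-antimono-≤ (p w′)) lower , ≤-trans upper (p w′)

  -- ℓ i s is the entry in column i of row s.
  Spans : ∀ {n d} → (Fin d → Fin n → Carrier) → (r : ℕ) → Set
  Spans {n} ℓ r = Σ[ β ∈ (Fin r → Fin n) ] (∀ s → Σ[ c ∈ (Fin r → Carrier) ]
    ((∀ j → c j ≤∣ 1# ∣) × (∀ i → ℓ i s ≈ sum (λ j → c j * ℓ i (β j)))))

  -- Adding row 0 with coefficient 0 pads a spanning family up to a prescribed length, so that all
  -- codes have the same format.
  spans-suc : ∀ {n d} (ℓ : Fin d → Fin (suc n) → Carrier) {r} → Spans ℓ r → Spans ℓ (suc r)
  spans-suc {n} ℓ {r} (β , sp) = β′ , λ s → let c , bd , eq = sp s in c′ c , c′-bd c bd ,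
    λ i → trans (eq i) (trans (sym (+-identityˡ _)) (+-congʳ (sym (zeroˡ _))))
    where
    β′ : Fin (suc r) → Fin (suc n)
    β′ zero    = zero
    β′ (suc j) = β j
    c′ : (Fin r → Carrier) → Fin (suc r) → Carrier
    c′ c zero    = 0#
    c′ c (suc j) = c j
    c′-bd : ∀ c → (∀ j → c j ≤∣ 1# ∣) → ∀ j → c′ c j ≤∣ 1# ∣
    c′-bd c bd zero    = ≤-trans (neg-antimono-≤ 0≤1) (≤-reflexive -0#≈0#) , 0≤1
    c′-bd c bd (suc j) = bd j

  spans-≤ : ∀ {n d} (ℓ : Fin d → Fin (suc n) → Carrier) {r r′} → r ℕ.≤′ r′ → Spans ℓ r → Spans ℓ r′
  spans-≤ ℓ (ℕ.≤′-reflexive ≡.refl) sp = sp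
  spans-≤ ℓ (ℕ.≤′-step r≤r′)        sp = spans-suc ℓ (spans-≤ ℓ r≤r′ sp)

  -- Cramer's rule for a minor of maximal absolute value among those of
  -- maximal order.
  spanner : ∀ {n d} (ℓ : Fin d → Fin (suc n) → Carrier) → Spans ℓ d
  spanner {n} ℓ with nondegenerateForm ℓ
  ... | r , r≤d , ω , (w₀ , nz) , z = spans-≤ ℓ (ℕ.≤⇒≤′ r≤d) (maximal ω w₀ nz z)
    where
    open Wedge em ℝ (Fin (suc n))
    maximal : ∀ {r} (ω : Form r) w₀ → ¬ ω w₀ ≈ 0# → (∀ i w → wedge (ℓ i) ω w ≈ 0#) → Spans ℓ r
    -- Rank 0: `ω` is a nonzero scalar, so every entry of the matrix vanishes and the empty family
    -- spans.
    maximal {zero} ω [] nz z = (λ ()) , λ s → (λ ()) , (λ ()) , λ i →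
      *-cancelˡ-≈0 nz (trans (*-comm _ _) (z i (s ∷ [])))
    maximal {suc r} ω w₀ nz z = cramer (argmaxAbs ω)
      where
      cramer : ∃[ w ] ∃[ m ] (0# ≤ m × (m ≈ ω w ⊎ m ≈ - ω w) × (∀ w′ → ω w′ ≤∣ m ∣)) → Spans ℓ (suc r)
      cramer (w , m , 0≤m , m≈±ω , bd) = lookup w , rows
        where
        m≉0 : ¬ m ≈ 0#
        m≉0 m≈0 = nz (≤-antisym
          (≤-trans (proj₂ (bd w₀)) (≤-reflexive m≈0))
          (≤-trans (≤-reflexive (sym (trans (-‿cong m≈0) -0#≈0#))) (proj₁ (bd w₀))))

        m⁻¹-bd : ∀ {x} → x ≤∣ m ∣ → m ⁻¹ * x ≤∣ 1# ∣
        m⁻¹-bd p = ≤∣∣-resp refl (trans (*-comm _ _) (*-inverseʳ m≉0)) (*-≤∣∣ (⁻¹-nonNeg 0≤m m≉0) p)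

        inverse : m ≈ ω w ⊎ m ≈ - ω w → ∃[ t ] (ω w * t ≈ 1# × (∀ {x} → x ≤∣ m ∣ → t * x ≤∣ 1# ∣))
        inverse (inj₁ m≈ω)  = m ⁻¹ , trans (*-congʳ (sym m≈ω)) (*-inverseʳ m≉0) , m⁻¹-bd
        inverse (inj₂ m≈-ω) = - m ⁻¹ ,
          trans (solve 2 (λ x y → x :* :- y := :- x :* y) refl (ω w) (m ⁻¹))
                (trans (*-congʳ (sym m≈-ω)) (*-inverseʳ m≉0)) ,
          λ {x} p → ≤∣∣-resp (solve 2 (λ x y → :- (x :* y) := :- x :* y) refl (m ⁻¹) x) refl (neg-≤∣∣ (m⁻¹-bd p))

        rows : ∀ s → Σ[ c ∈ (Fin (suc r) → Carrier) ]
          ((∀ j → c j ≤∣ 1# ∣) × (∀ i → ℓ i s ≈ sum (λ j → c j * ℓ i (lookup w j))))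
        rows s =
          let t , ωt≈1 , t-bd = inverse m≈±ω
              c , c-bd , exp  = wedge-expand (λ u → ω (s ∷ u)) m (λ u → bd (s ∷ u)) w
          in (λ j → t * c j) , (λ j → t-bd (c-bd j)) , λ i → begin-equality
          ℓ i s
            ≈⟨ solve 1 (λ x → x := x :* con (+ 1)) refl (ℓ i s) ⟩
          ℓ i s * 1#
            ≈⟨ *-congˡ ωt≈1 ⟨
          ℓ i s * (ω w * t)
            ≈⟨ solve 4 (λ l x t y → l :* (x :* t) := t :* ((l :* x :- y) :+ y)) refl (ℓ i s) (ω w) t _ ⟩
          t * ((ℓ i s * ω w - wedge (ℓ i) (λ u → ω (s ∷ u)) w) + wedge (ℓ i) (λ u → ω (s ∷ u)) w)
            -- The vanishing of `ℓ i` wedged with `ω` at `s ∷ w` determines `ℓ i s`. The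
            -- coefficients `c j` are, up to sign, values of `ω` at tuples starting with `s`, so
            -- dividing by the extreme value `ω w` leaves them in [-1, 1].
            ≈⟨ *-congˡ (+-cong (z i (s ∷ w)) (exp (ℓ i))) ⟩
          t * (0# + sum (λ j → c j * ℓ i (lookup w j)))
            ≈⟨ *-congˡ (+-identityˡ _) ⟩
          t * sum (λ j → c j * ℓ i (lookup w j))
            ≈⟨ *-distribˡ-sum t (λ j → c j * ℓ i (lookup w j)) ⟩
          sum (λ j → t * (c j * ℓ i (lookup w j)))
            ≈⟨ sum-cong (λ j → *-assoc t (c j) (ℓ i (lookup w j))) ⟨
          sum (λ j → t * c j * ℓ i (lookup w j)) ∎

-- Finite cardinalities and minima from excluded middle.

module Classical (em : ExcludedMiddle 0ℓ) where

  ¬¬-elim : {A : Set} → ¬ ¬ A → A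
  ¬¬-elim {A} ¬¬a with em {A}
  ... | yes a = a
  ... | no ¬a = contradiction ¬a ¬¬a

  subset : ∀ {n} → Pred (Fin n) 0ℓ → Subset n
  subset P = tabulate (λ i → does (em {P i}))

  ∈-subset⁺ : ∀ {n} {P : Pred (Fin n) 0ℓ} {i} → P i → i Subset.∈ subset P
  ∈-subset⁺ {P = P} {i} Pi = lookup⇒[]= i (subset P)
    (≡.trans (lookup∘tabulate (λ j → does (em {P j})) i) does≡true)
    where
    does≡true : does (em {P i}) ≡ true
    does≡true with em {P i}
    ... | yes _  = ≡.refl
    ... | no ¬Pi = contradiction Pi ¬Pi

  ∈-subset⁻ : ∀ {n} {P : Pred (Fin n) 0ℓ} {i} → i Subset.∈ subset P → P i
  ∈-subset⁻ {P = P} {i} i∈ = P-of (≡.trans (≡.sym (lookup∘tabulate (λ j → does (em {P j})) i)) ([]=⇒lookup i∈))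
    where
    P-of : does (em {P i}) ≡ true → P i
    P-of eq with em {P i}
    ... | yes Pi = Pi
    P-of () | no _

  subset-⊂ : ∀ {n} {P Q : Pred (Fin n) 0ℓ} → P ⊆ Q → ∀ {i} → Q i → ¬ P i → subset P ⊂ subset Q
  subset-⊂ P⊆Q Qi ¬Pi = (λ j∈ → ∈-subset⁺ (P⊆Q (∈-subset⁻ j∈))) ,
    _ , ∈-subset⁺ Qi , λ i∈ → ¬Pi (∈-subset⁻ i∈)

  -- Induction on a bound for the codes. Code t adds at most one class, and none if its elements are
  -- already represented: equivalent elements may have different codes.
  finitelyMany : ∀ {A : Set} {_~_ : Rel A 0ℓ} {P : Pred A 0ℓ} {N} (code : A → Fin N) →
                 Symmetric _~_ → (∀ {x y} → P x → P y → code x ≡ code y → x ~ y) →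
                 ∃ (HasCardinality _~_ P)
  finitelyMany {A} {_~_} {P} {N} code ~-sym code-~ with upTo N
    where
    open HasCardinality
    upTo : ∀ t → ∃ (HasCardinality _~_ (λ x → P x × Fin.toℕ (code x) ℕ.< t))
    upTo zero = 0 , record { enum = λ () ; sound = λ () ; injective = λ { {()} } ; complete = λ { (_ , ()) } }
    upTo (suc t) with upTo t
    ... | n , H with em {∃[ x ] (P x × Fin.toℕ (code x) ≡ t × (∀ i → ¬ enum H i ~ x))}
    ...   | yes (a , Pa , code≡t , new) = suc n , record
      { enum      = enum′
      ; sound     = λ { zero    → Pa , ℕ.≤-reflexive (≡.cong suc code≡t)
                      ; (suc i) → let p , lt = sound H i in p , ℕ.m<n⇒m<1+n lt }
      ; injective = injective′
      ; complete  = λ { (Px , lt) → complete′ Px (ℕ.m<1+n⇒m<n∨m≡n lt) }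
      }
      where
      enum′ : Fin (suc n) → A
      enum′ zero    = a
      enum′ (suc i) = enum H i
      injective′ : ∀ {i j} → enum′ i ~ enum′ j → i ≡ j
      injective′ {zero}  {zero}  p = ≡.refl
      injective′ {zero}  {suc j} p = contradiction (~-sym p) (new j)
      injective′ {suc i} {zero}  p = contradiction p (new i)
      injective′ {suc i} {suc j} p = ≡.cong suc (injective H p)
      complete′ : ∀ {x} → P x → Fin.toℕ (code x) ℕ.< t ⊎ Fin.toℕ (code x) ≡ t → ∃[ i ] (enum′ i ~ x)
      complete′ Px (inj₁ lt) = let i , p = complete H (Px , lt) in suc i , p
      complete′ Px (inj₂ eq) = zero , code-~ Pa Px (Fin.toℕ-injective (≡.trans code≡t (≡.sym eq)))
    ...   | no nothing-new = n , record
      { enum      = enum H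
      ; sound     = λ i → let p , lt = sound H i in p , ℕ.m<n⇒m<1+n lt
      ; injective = injective H
      ; complete  = λ { (Px , lt) → complete′ Px (ℕ.m<1+n⇒m<n∨m≡n lt) }
      }
      where
      complete′ : ∀ {x} → P x → Fin.toℕ (code x) ℕ.< t ⊎ Fin.toℕ (code x) ≡ t → ∃[ i ] (enum H i ~ x)
      complete′ Px (inj₁ lt) = complete H (Px , lt)
      complete′ {x} Px (inj₂ eq) = ¬¬-elim λ none →
        nothing-new (x , Px , eq , λ i p → none (i , p))
  ... | n , H = n , record
    { enum      = enum H
    ; sound     = λ i → proj₁ (sound H i)
    ; injective = injective H
    ; complete  = λ Px → complete H (Px , Fin.toℕ<n _)
    }
    where open HasCardinality

  least : (S : Pred ℕ 0ℓ) → ∀ {n} → S n → ∃[ k ] (S k × (∀ {j} → S j → k ℕ.≤ j))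
  least S {n} = go (<-wellFounded n)
    where
    go : ∀ {n} → Acc ℕ._<_ n → S n → ∃[ k ] (S k × (∀ {j} → S j → k ℕ.≤ j))
    go {n} (acc rec) Sn with em {∃[ j ] (j ℕ.< n × S j)}
    ... | yes (j , j<n , Sj) = go (rec j<n) Sj
    ... | no  none = n , Sn , λ {j} Sj → ℕ.≮⇒≥ λ j<n → none (j , j<n , Sj)

-- Faces and facets read off from the generators.

module Faces (em : ExcludedMiddle 0ℓ) (ℝ : CompleteOrderedField) where
  open OrderedField em ℝ
  open Classical em
  open Polytopes ℝ hiding (sum)
  open Polytope
  open _∈conv_
  open Inequality

  slack : ∀ {d} → Inequality d → Point d → Carrier
  slack h x = bound h - normal h ∙ x

  ∙-congˡ : ∀ {d} (a : Point d) {x y} → x ≋ y → a ∙ x ≈ a ∙ y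
  ∙-congˡ a x≋y = sum-cong λ i → *-congˡ (x≋y i)

  slack-cong : ∀ {d} (h : Inequality d) {x y} → x ≋ y → slack h x ≈ slack h y
  slack-cong h x≋y = +-congˡ (-‿cong (∙-congˡ (normal h) x≋y))

  tight⇒slack≈0 : ∀ {d} (h : Inequality d) {x} → normal h ∙ x ≈ bound h → slack h x ≈ 0#
  tight⇒slack≈0 h p = trans (+-congˡ (-‿cong p)) (-‿inverseʳ _)

  slack≈0⇒tight : ∀ {d} (h : Inequality d) {x} → slack h x ≈ 0# → normal h ∙ x ≈ bound h
  slack≈0⇒tight h {x} p = begin-equality
    normal h ∙ x                     ≈⟨ solve 2 (λ a b → a := b :- (b :- a)) refl (normal h ∙ x) (bound h) ⟩
    bound h - slack h x              ≈⟨ +-congˡ (-‿cong p) ⟩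
    bound h - 0#                     ≈⟨ solve 1 (λ b → b :- con (+ 0) := b) refl (bound h) ⟩
    bound h                          ∎

  ∙-combination : ∀ {d m} (a : Point d) (w : Fin m → Carrier) (g : Fin m → Point d) →
                  a ∙ (λ i → sum λ j → w j * g j i) ≈ sum λ j → w j * (a ∙ g j)
  ∙-combination a w g = begin-equality
    (sum λ i → a i * sum λ j → w j * g j i)
      ≈⟨ sum-cong (λ i → *-distribˡ-sum (a i) (λ j → w j * g j i)) ⟩
    (sum λ i → sum λ j → a i * (w j * g j i))
      ≈⟨ ∑-comm (λ i j → a i * (w j * g j i)) ⟩
    (sum λ j → sum λ i → a i * (w j * g j i))
      ≈⟨ sum-cong (λ j → sum-cong λ i → solve 3 (λ a w g → a :* (w :* g) := w :* (a :* g)) refl (a i) (w j) (g j i)) ⟩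
    (sum λ j → sum λ i → w j * (a i * g j i))
      ≈⟨ sum-cong (λ j → *-distribˡ-sum (w j) (λ i → a i * g j i)) ⟨
    (sum λ j → w j * (a ∙ g j)) ∎

  -- Weights that sum to 1 also average the constant term. This reduces statements about faces to
  -- the finitely many slacks at generators.
  slack-combination : ∀ {d} {P : Polytope d} h {x} (x∈P : x ∈ ⟦ P ⟧) →
                      slack h x ≈ sum λ j → weight x∈P j * slack h (generator P j)
  slack-combination {P = P} h {x} x∈P = begin-equality
    bound h - normal h ∙ x
      ≈⟨ +-cong (sym (*-identityˡ _))
                (-‿cong (trans (∙-congˡ (normal h) (combine x∈P)) (∙-combination (normal h) w g))) ⟩
    1# * bound h - (sum λ j → w j * (normal h ∙ g j))
      ≈⟨ +-congʳ (*-congʳ (sum≈1 x∈P)) ⟨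
    sum w * bound h - (sum λ j → w j * (normal h ∙ g j))
      ≈⟨ +-congʳ (*-distribʳ-sum (bound h) w) ⟩
    (sum λ j → w j * bound h) - (sum λ j → w j * (normal h ∙ g j))
      ≈⟨ sum-sub (λ j → w j * bound h) (λ j → w j * (normal h ∙ g j)) ⟨
    (sum λ j → w j * bound h - w j * (normal h ∙ g j))
      ≈⟨ sum-cong (λ j → x[y-z]≈xy-xz (w j) (bound h) (normal h ∙ g j)) ⟨
    (sum λ j → w j * slack h (g j)) ∎
    where
    w = weight x∈P
    g = generator P

  δ : ∀ {m} → Fin m → Fin m → Carrier
  δ i j with i Fin.≟ j
  ... | yes _ = 1#
  ... | no  _ = 0#

  δ-diag : ∀ {m} (i : Fin m) → δ i i ≈ 1#
  δ-diag i with i Fin.≟ i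
  ... | yes _  = refl
  ... | no i≢i = contradiction ≡.refl i≢i

  δ-off : ∀ {m} {i j : Fin m} → ¬ j ≡ i → δ i j ≈ 0#
  δ-off {i = i} {j} j≢i with i Fin.≟ j
  ... | yes i≡j = contradiction (≡.sym i≡j) j≢i
  ... | no  _   = refl

  δ-nonNeg : ∀ {m} (i j : Fin m) → 0# ≤ δ i j
  δ-nonNeg i j with i Fin.≟ j
  ... | yes _ = 0≤1
  ... | no  _ = ≤-refl

  sum-δ : ∀ {m} (i : Fin m) (f : Fin m → Carrier) → (sum λ j → δ i j * f j) ≈ f i
  sum-δ i f = begin-equality
    (sum λ j → δ i j * f j)  ≈⟨ sum-single i (λ j j≢i → trans (*-congʳ (δ-off j≢i)) (zeroˡ (f j))) ⟩
    δ i i * f i              ≈⟨ *-congʳ (δ-diag i) ⟩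
    1# * f i                 ≈⟨ *-identityˡ (f i) ⟩
    f i                      ∎

  generator∈ : ∀ {d} (P : Polytope d) j → generator P j ∈ ⟦ P ⟧
  generator∈ P j = record
    { weight  = δ j
    ; nonNeg  = δ-nonNeg j
    ; sum≈1   = trans (sum-single j (λ i i≢j → δ-off i≢j)) (δ-diag j)
    ; combine = λ i → sym (sum-δ j (λ k → generator P k i))
    }

  ∈conv-resp-≋ : ∀ {d} {P : Polytope d} {x y} → x ≋ y → x ∈ ⟦ P ⟧ → y ∈ ⟦ P ⟧
  ∈conv-resp-≋ x≋y x∈P = record
    { weight  = weight x∈P
    ; nonNeg  = nonNeg x∈P
    ; sum≈1   = sum≈1 x∈P
    ; combine = λ i → trans (sym (x≋y i)) (combine x∈P i)
    }

  module _ {d} {P : Polytope d} where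

    slackVector : Inequality d → Fin (size P) → Carrier
    slackVector h j = slack h (generator P j)

    valid⁺ : ∀ {h} → (∀ j → 0# ≤ slackVector h j) → Valid P h
    valid⁺ {h} p x∈P = 0≤y-x⇒x≤y (≤-trans
      (sum-nonNeg (λ j → *-nonNeg (nonNeg x∈P j) (p j)))
      (≤-reflexive (sym (slack-combination h x∈P))))

    valid⁻ : ∀ {h} → Valid P h → ∀ j → 0# ≤ slackVector h j
    valid⁻ v j = 0≤y-x (v (generator∈ P j))

    weight*slack≈0 : ∀ {h x} → Valid P h → ((x∈P , _) : x ∈ face P h) → ∀ j → weight x∈P j * slackVector h j ≈ 0#
    weight*slack≈0 {h} v (x∈P , tight) = sum≈0⇒term≈0
      (λ j → *-nonNeg (nonNeg x∈P j) (valid⁻ v j))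
      (trans (sym (slack-combination h x∈P)) (tight⇒slack≈0 h tight))

    generator∈face : ∀ h {j} → slackVector h j ≈ 0# → generator P j ∈ face P h
    generator∈face h p = generator∈ P _ , slack≈0⇒tight h p

    infix 4 _≼_

    _≼_ : Rel (Inequality d) 0ℓ
    h ≼ h′ = ∀ {j} → slackVector h j ≈ 0# → slackVector h′ j ≈ 0#

    face⊆⇒≼ : ∀ {h h′} → face P h ⊆ face P h′ → h ≼ h′
    face⊆⇒≼ {h} {h′} sub p = tight⇒slack≈0 h′ (proj₂ (sub (generator∈face h p)))

    -- At a point of the face of `h` the nonnegative terms weight times slack sum to 0, so only
    -- generators on that face carry weight.
    ≼⇒face⊆ : ∀ {h h′} → Valid P h → h ≼ h′ → face P h ⊆ face P h′
    ≼⇒face⊆ {h} {h′} v h≼h′ x∈F@(x∈P , _) = x∈P , slack≈0⇒tight h′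
      (trans (slack-combination h′ x∈P) (sum-zero term))
      where
      term : ∀ j → weight x∈P j * slackVector h′ j ≈ 0#
      term j with em {weight x∈P j ≈ 0#}
      ... | yes w≈0 = trans (*-congʳ w≈0) (zeroˡ _)
      ... | no  w≉0 = trans (*-congˡ (h≼h′ (*-cancelˡ-≈0 w≉0 (weight*slack≈0 v x∈F j)))) (zeroʳ _)

    proper⁺ : ∀ {h j} → Valid P h → ¬ slackVector h j ≈ 0# → DefinesProperFace P h
    proper⁺ {h} {j} v nz = v , λ sub → nz (tight⇒slack≈0 h (proj₂ (sub (generator∈ P j))))

    proper⁻ : ∀ {h} → DefinesProperFace P h → ∃[ j ] ¬ slackVector h j ≈ 0#
    proper⁻ {h} (v , ¬sub) = ¬¬-elim λ none → ¬sub λ x∈P → x∈P , slack≈0⇒tight h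
      (trans (slack-combination h x∈P)
        (sum-zero λ j → trans (*-congˡ (¬¬-elim λ nz → none (j , nz))) (zeroʳ _)))

    -- The generators off the face: growing a face shrinks this set, which makes well-founded
    -- induction available.
    support : Inequality d → Subset (size P)
    support h = subset λ j → ¬ slackVector h j ≈ 0#

    support-⊂ : ∀ {h h′ j} → h ≼ h′ → slackVector h′ j ≈ 0# → ¬ slackVector h j ≈ 0# → support h′ ⊂ support h
    support-⊂ h≼h′ z nz = subset-⊂ (λ nz′ z → nz′ (h≼h′ z)) nz (λ nz′ → nz′ z)

    -- Passing to a strictly larger proper face shrinks the support, so the passage ends at a
    -- maximal one.
    facetAbove : ∀ {h} → DefinesProperFace P h → ∃[ g ] (DefinesFacet P g × h ≼ g)
    facetAbove {h} = go (⊂-wellFounded (support h))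
      where
      go : ∀ {h} → Acc _⊂_ (support h) → DefinesProperFace P h → ∃[ g ] (DefinesFacet P g × h ≼ g)
      go {h} (acc rec) pf with em {∃[ h′ ] (DefinesProperFace P h′ × h ≼ h′ × ∃[ j ] (slackVector h′ j ≈ 0# × ¬ slackVector h j ≈ 0#))}
      ... | yes (h′ , pf′ , h≼h′ , j , z , nz) =
        let g , facet , h′≼g = go (rec (support-⊂ {h} {h′} h≼h′ z nz)) pf′
        in g , facet , λ z → h′≼g (h≼h′ z)
      ... | no none = h , (pf , λ {h′} pf′ sub → ≼⇒face⊆ (proj₁ pf′)
              (λ {j} z → ¬¬-elim λ nz → none (h′ , pf′ , face⊆⇒≼ {h} {h′} sub , j , z , nz))) , λ z → z

    -- The pattern of vanishing slacks at the generators determines the face and takes finitely many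
    -- values.
    hasFacetCount : ∃ (HasFacetCount P)
    hasFacetCount = finitelyMany (λ h → Fin.funToFin (vanishing h)) (λ (p , q) → q , p)
      λ {h} {h′} ((v , _) , _) ((v′ , _) , _) eq →
        let vanishing≗ = λ j → ≡.trans (≡.sym (Fin.finToFun-funToFin (vanishing h) j))
                          (≡.trans (≡.cong (λ c → Fin.finToFun c j) eq) (Fin.finToFun-funToFin (vanishing h′) j))
        in ≼⇒face⊆ v (λ {j} z → vanishes⁻ h′ (≡.trans (≡.sym (vanishing≗ j)) (vanishes⁺ h z))) ,
           ≼⇒face⊆ v′ (λ {j} z → vanishes⁻ h (≡.trans (vanishing≗ j) (vanishes⁺ h′ z)))
      where
      vanishing : Inequality d → Fin (size P) → Fin 2
      vanishing h j with em {slackVector h j ≈ 0#}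
      ... | yes _ = zero
      ... | no  _ = suc zero
      vanishes⁺ : ∀ h {j} → slackVector h j ≈ 0# → vanishing h j ≡ zero
      vanishes⁺ h {j} z with em {slackVector h j ≈ 0#}
      ... | yes _ = ≡.refl
      ... | no nz = contradiction z nz
      vanishes⁻ : ∀ h {j} → vanishing h j ≡ zero → slackVector h j ≈ 0#
      vanishes⁻ h {j} eq with em {slackVector h j ≈ 0#}
      ... | yes z = z
      vanishes⁻ h {j} () | no _

  -- `P` extends itself, so the set of sizes is nonempty and has a least element.
  hasExtensionComplexity : ∀ {d} (P : Polytope d) → ∃ (HasExtensionComplexity P)
  hasExtensionComplexity {d} P =
    let k , facets = hasFacetCount {P = P}
    in least (HasExtensionOfSize P) (d , P , identity , facets)
    where
    identity : IsExtension P P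
    identity = record
      { projection = δ
      ; image      = (λ {x} x∈P → x , x∈P , λ i → sum-δ i x) ,
                     λ { (y , y∈P , eq) → ∈conv-resp-≋ (λ i → trans (sym (sum-δ i y)) (eq i)) y∈P }
      }

-- Facet inequalities generate all valid ones; factorisation of slack matrices.

module FacetDecomposition (em : ExcludedMiddle 0ℓ) (ℝ : CompleteOrderedField) where
  open OrderedField em ℝ
  open Classical em
  open Faces em ℝ
  open Polytopes ℝ hiding (sum)
  open Polytope
  open _∈conv_
  open Inequality
  open HasCardinality

  -- The right t is the minimum of a / b over nonzero b. Maximising `b j * a j ⁻¹` avoids that side
  -- condition: where `a j` vanishes so does `b j`, and the product is 0 whatever the unspecified
  -- inverse.
  maximalScale : ∀ {m} (a b : Fin m → Carrier) → (∀ j → 0# ≤ a j) → (∀ j → 0# ≤ b j) →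
    (∀ {j} → a j ≈ 0# → b j ≈ 0#) → ∃[ j ] ¬ b j ≈ 0# →
    ∃[ t ] (0# ≤ t × (∀ j → t * b j ≤ a j) × ∃[ j ] (¬ b j ≈ 0# × t * b j ≈ a j))
  maximalScale {suc m} a b 0≤a 0≤b a≈0⇒b≈0 (j₀ , b₀≉0) with argmax (λ j → b j * a j ⁻¹)
  ... | k , max = t , 0≤t , below , k , bₖ≉0 , exact
    where
    a≉0 : ∀ {j} → ¬ b j ≈ 0# → ¬ a j ≈ 0#
    a≉0 b≉0 a≈0 = b≉0 (a≈0⇒b≈0 a≈0)
    bₖ≉0 : ¬ b k ≈ 0#
    bₖ≉0 bₖ≈0 = b₀≉0 (*-cancelˡ-≈0 a⁻¹≉0 (trans (*-comm _ _) (≤-antisym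
      (≤-trans (max j₀) (≤-reflexive (trans (*-congʳ bₖ≈0) (zeroˡ _))))
      (*-nonNeg (0≤b j₀) (⁻¹-nonNeg (0≤a j₀) (a≉0 b₀≉0))))))
      where
      a⁻¹≉0 : ¬ a j₀ ⁻¹ ≈ 0#
      a⁻¹≉0 p = 0≉1 (trans (sym (trans (*-congˡ p) (zeroʳ _))) (*-inverseʳ (a≉0 b₀≉0)))
    t = a k * b k ⁻¹
    0≤t : 0# ≤ t
    0≤t = *-nonNeg (0≤a k) (⁻¹-nonNeg (0≤b k) bₖ≉0)
    exact : t * b k ≈ a k
    exact = begin-equality
      a k * b k ⁻¹ * b k      ≈⟨ solve 3 (λ a i b → a :* i :* b := a :* (b :* i)) refl (a k) (b k ⁻¹) (b k) ⟩
      a k * (b k * b k ⁻¹)    ≈⟨ *-congˡ (*-inverseʳ bₖ≉0) ⟩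
      a k * 1#                ≈⟨ *-identityʳ _ ⟩
      a k                     ∎
    below : ∀ j → t * b j ≤ a j
    below j with em {a j ≈ 0#}
    ... | yes aⱼ≈0 = ≤-trans (≤-reflexive (trans (*-congˡ (a≈0⇒b≈0 aⱼ≈0)) (zeroʳ t))) (0≤a j)
    ... | no  aⱼ≉0 = begin
      t * b j
        ≈⟨ *-identityʳ _ ⟨
      t * b j * 1#
        ≈⟨ *-congˡ (*-inverseʳ aⱼ≉0) ⟨
      t * b j * (a j * a j ⁻¹)
        ≈⟨ solve 4 (λ t b a i → t :* b :* (a :* i) := a :* t :* (b :* i)) refl t (b j) (a j) (a j ⁻¹) ⟩
      a j * t * (b j * a j ⁻¹)
        ≤⟨ *-monoˡ-≤ (*-nonNeg (0≤a j) 0≤t) (max j) ⟩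
      a j * t * (b k * a k ⁻¹)
        ≈⟨ solve 5 (λ a t b c i → a :* t :* (b :* i) := a :* (t :* b :* i)) refl (a j) t (b k) (a k) (a k ⁻¹) ⟩
      a j * (t * b k * a k ⁻¹)
        ≈⟨ *-congˡ (*-congʳ exact) ⟩
      a j * (a k * a k ⁻¹)
        ≈⟨ *-congˡ (*-inverseʳ (a≉0 bₖ≉0)) ⟩
      a j * 1#
        ≈⟨ *-identityʳ _ ⟩
      a j ∎

  infix 6 _⊖_·_

  _⊖_·_ : ∀ {d} → Inequality d → Carrier → Inequality d → Inequality d
  h ⊖ t · g = record { normal = λ i → normal h i - t * normal g i ; bound = bound h - t * bound g }

  slack-⊖ : ∀ {d} (h : Inequality d) t g x → slack (h ⊖ t · g) x ≈ slack h x - t * slack g x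
  slack-⊖ h t g x = begin-equality
    bound h - t * bound g - (sum λ i → (normal h i - t * normal g i) * x i)
      ≈⟨ +-congˡ (-‿cong normal-⊖) ⟩
    bound h - t * bound g - (normal h ∙ x - t * (normal g ∙ x))
      ≈⟨ solve 5 (λ a t b p q → a :- t :* b :- (p :- t :* q) := a :- p :- t :* (b :- q)) refl
           (bound h) t (bound g) (normal h ∙ x) (normal g ∙ x) ⟩
    slack h x - t * slack g x ∎
    where
    normal-⊖ : (sum λ i → (normal h i - t * normal g i) * x i) ≈ normal h ∙ x - t * (normal g ∙ x)
    normal-⊖ = begin-equality
      (sum λ i → (normal h i - t * normal g i) * x i)
        ≈⟨ sum-cong (λ i → solve 4 (λ a t b x → (a :- t :* b) :* x := a :* x :- t :* (b :* x)) refl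
                             (normal h i) t (normal g i) (x i)) ⟩
      (sum λ i → normal h i * x i - t * (normal g i * x i))
        ≈⟨ sum-sub (λ i → normal h i * x i) (λ i → t * (normal g i * x i)) ⟩
      normal h ∙ x - (sum λ i → t * (normal g i * x i))
        ≈⟨ +-congˡ (-‿cong (*-distribˡ-sum t (λ i → normal g i * x i))) ⟨
      normal h ∙ x - t * (normal g ∙ x) ∎

  module _ {d} {P : Polytope d} {k} (facets : HasFacetCount P k) where

    private
      sv : Inequality d → Fin (size P) → Carrier
      sv = slackVector {P = P}

      s : Fin k → Inequality d
      s = enum facets

      Decomposition : Inequality d → Set
      Decomposition h = Σ[ c ∈ (Fin k → Carrier) ]
        ((∀ i → 0# ≤ c i) × (∀ j → sv h j ≈ sum λ i → c i * sv (s i) j))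

      Below : Inequality d → Inequality d → Set
      Below h′ h = Valid P h′ × support {P = P} h′ ⊂ support {P = P} h

    -- The facet is chosen to contain the face of `h`, so every zero of the slack of `h` survives;
    -- the extremal multiple creates another.
    subtractFacet : ∀ {h} → Valid P h → ∃[ j ] ¬ sv h j ≈ 0# →
                    ∃[ i ] ∃[ t ] (0# ≤ t × Below (h ⊖ t · s i) h)
    subtractFacet {h} v (j₀ , nz) = i , scale (maximalScale (sv h) (sv (s i)) (valid⁻ v)
      (valid⁻ (proj₁ (proj₁ (sound facets i)))) h≼s (proper⁻ (proj₁ (sound facets i))))
      where
      above : ∃[ g ] (DefinesFacet P g × _≼_ {P = P} h g)
      above = facetAbove (proper⁺ {P = P} {h} v nz)
      g = proj₁ above
      g-index : ∃[ i ] SameFace P (s i) g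
      g-index = complete facets (proj₁ (proj₂ above))
      i = proj₁ g-index
      h≼s : _≼_ {P = P} h (s i)
      h≼s z = face⊆⇒≼ {P = P} {g} {s i} (proj₂ (proj₂ g-index)) (proj₂ (proj₂ above) z)
      scale : ∃[ t ] (0# ≤ t × (∀ j → t * sv (s i) j ≤ sv h j) ×
                      ∃[ j ] (¬ sv (s i) j ≈ 0# × t * sv (s i) j ≈ sv h j)) →
              ∃[ t ] (0# ≤ t × Below (h ⊖ t · s i) h)
      scale (t , 0≤t , below , l , sₗ≉0 , exact) = t , 0≤t , v′ ,
        support-⊂ {P = P} {h} {h′} h≼h′ h′ₗ≈0 (λ z → sₗ≉0 (h≼s z))
        where
        h′ : Inequality d
        h′ = h ⊖ t · s i
        h≼h′ : _≼_ {P = P} h h′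
        h≼h′ {j} z = begin-equality
          sv h′ j                   ≈⟨ slack-⊖ h t (s i) (generator P j) ⟩
          sv h j - t * sv (s i) j   ≈⟨ +-cong z (-‿cong (*-congˡ (h≼s z))) ⟩
          0# - t * 0#               ≈⟨ solve 1 (λ t → con (+ 0) :- t :* con (+ 0) := con (+ 0)) refl t ⟩
          0#                        ∎
        h′ₗ≈0 : sv h′ l ≈ 0#
        h′ₗ≈0 = trans (slack-⊖ h t (s i) (generator P l)) (trans (+-congˡ (-‿cong exact)) (-‿inverseʳ _))
        v′ : Valid P h′
        v′ = valid⁺ λ j → ≤-trans (0≤y-x (below j)) (≤-reflexive (sym (slack-⊖ h t (s i) (generator P j))))

    addFacet : ∀ {h} i t → 0# ≤ t → Decomposition (h ⊖ t · s i) → Decomposition h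
    addFacet {h} i t 0≤t (c , 0≤c , eq) = (λ l → c l + δ i l * t) ,
      (λ l → +-nonNeg (0≤c l) (*-nonNeg (δ-nonNeg i l) 0≤t)) , λ j → begin-equality
        sv h j
          ≈⟨ solve 2 (λ x y → x := x :- y :+ y) refl (sv h j) (t * sv (s i) j) ⟩
        sv h j - t * sv (s i) j + t * sv (s i) j
          ≈⟨ +-congʳ (slack-⊖ h t (s i) (generator P j)) ⟨
        sv (h ⊖ t · s i) j + t * sv (s i) j
          ≈⟨ +-cong (eq j) (sym (sum-δ i (λ l → t * sv (s l) j))) ⟩
        (sum λ l → c l * sv (s l) j) + (sum λ l → δ i l * (t * sv (s l) j))
          ≈⟨ ∑-distrib-+ (λ l → c l * sv (s l) j) (λ l → δ i l * (t * sv (s l) j)) ⟨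
        (sum λ l → c l * sv (s l) j + δ i l * (t * sv (s l) j))
          ≈⟨ sum-cong (λ l → solve 4 (λ c s d t → c :* s :+ d :* (t :* s) := (c :+ d :* t) :* s) refl
                               (c l) (sv (s l) j) (δ i l) t) ⟩
        (sum λ l → (c l + δ i l * t) * sv (s l) j) ∎

    -- Subtract the largest possible multiple of a facet inequality whose
    -- slack vanishes wherever that of h does: the support shrinks.
    facetDecomposition-generators : ∀ {h} → Valid P h → Decomposition h
    facetDecomposition-generators {h} = go (⊂-wellFounded (support {P = P} h))
      where
      go : ∀ {h} → Acc _⊂_ (support {P = P} h) → Valid P h → Decomposition h
      go {h} (acc rec) v = split em
        where
        split : Dec (∃[ j ] ¬ sv h j ≈ 0#) → Decomposition h
        split (no none) = (λ _ → 0#) , (λ _ → ≤-refl) , λ j →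
          trans (¬¬-elim λ nz → none (j , nz)) (sym (sum-zero λ i → zeroˡ (sv (s i) j)))
        split (yes nz) =
          let i , t , 0≤t , v′ , shrinks = subtractFacet v nz
          in addFacet {h} i t 0≤t (go (rec shrinks) v′)

    -- A form of Farkas' lemma, stated as an identity on `P` only. Both sides are affine, so
    -- agreement at the generators extends to their convex hull.
    facetDecomposition : ∀ {h} → Valid P h →
      Σ[ c ∈ (Fin k → Carrier) ] ((∀ i → 0# ≤ c i) ×
        (∀ {x} → x ∈ ⟦ P ⟧ → slack h x ≈ sum λ i → c i * slack (enum facets i) x))
    facetDecomposition {h} v with facetDecomposition-generators v
    ... | c , 0≤c , eq = c , 0≤c , λ {x} x∈P →
      let w = weight x∈P
          s = λ i → slackVector {P = P} (enum facets i)
      in begin-equality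
      slack h x
        ≈⟨ slack-combination h x∈P ⟩
      (sum λ j → w j * slackVector {P = P} h j)
        ≈⟨ sum-cong (λ j → trans (*-congˡ (eq j)) (*-distribˡ-sum (w j) (λ i → c i * s i j))) ⟩
      (sum λ j → sum λ i → w j * (c i * s i j))
        ≈⟨ ∑-comm (λ j i → w j * (c i * s i j)) ⟩
      (sum λ i → sum λ j → w j * (c i * s i j))
        ≈⟨ sum-cong (λ i → sum-cong λ j → solve 3 (λ w c s → w :* (c :* s) := c :* (w :* s)) refl (w j) (c i) (s i j)) ⟩
      (sum λ i → sum λ j → c i * (w j * s i j))
        ≈⟨ sum-cong (λ i → *-distribˡ-sum (c i) (λ j → w j * s i j)) ⟨
      (sum λ i → c i * sum λ j → w j * s i j)
        ≈⟨ sum-cong (λ i → *-congˡ (slack-combination (enum facets i) x∈P)) ⟨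
      (sum λ i → c i * slack (enum facets i) x) ∎

  -- The direction of Yannakakis' factorisation theorem that gives lower bounds.
  slackFactorization : ∀ {d} {P : Polytope d} {k} → HasExtensionOfSize P k →
    ∀ {m n} (h : Fin m → Inequality d) (x : Fin n → Point d) →
    (∀ a → Valid P (h a)) → (∀ b → x b ∈ ⟦ P ⟧) →
    Σ[ u ∈ (Fin m → Fin k → Carrier) ] Σ[ v ∈ (Fin n → Fin k → Carrier) ]
      ((∀ a i → 0# ≤ u a i) × (∀ b i → 0# ≤ v b i) ×
       (∀ a b → slack (h a) (x b) ≈ sum λ i → u a i * v b i))
  slackFactorization {d} {P} {k} (e , Q , ext , facets) {m} {n} h x valid x∈P =
    -- `u` consists of facet coefficients of the inequality pulled back to `Q`, `v` of facet slacks
    -- at a preimage of the point.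
    (λ a → proj₁ (decomp a)) , (λ b i → slack (enum facets i) (y b)) ,
    (λ a → proj₁ (proj₂ (decomp a))) ,
    (λ b i → 0≤y-x (proj₁ (proj₁ (sound facets i)) (y∈Q b))) ,
    λ a b → trans (slack-cong (h a) (λ i → sym (My≋x b i)))
             (trans (sym (slack-pullback (h a) (y b))) (proj₂ (proj₂ (decomp a)) (y∈Q b)))
    where
    open IsExtension ext
    y : Fin n → Point e
    y b = proj₁ (proj₁ image (x∈P b))
    y∈Q : ∀ b → y b ∈ ⟦ Q ⟧
    y∈Q b = proj₁ (proj₂ (proj₁ image (x∈P b)))
    My≋x : ∀ b → apply projection (y b) ≋ x b
    My≋x b = proj₂ (proj₂ (proj₁ image (x∈P b)))
    pullback : Inequality d → Inequality e
    pullback h = record { normal = λ l → sum λ i → normal h i * projection i l ; bound = bound h }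
    slack-pullback : ∀ h z → slack (pullback h) z ≈ slack h (apply projection z)
    slack-pullback h z = +-congˡ (-‿cong (begin-equality
      (sum λ l → (sum λ i → normal h i * projection i l) * z l)
        ≈⟨ sum-cong (λ l → *-distribʳ-sum (z l) (λ i → normal h i * projection i l)) ⟩
      (sum λ l → sum λ i → normal h i * projection i l * z l)
        ≈⟨ ∑-comm (λ l i → normal h i * projection i l * z l) ⟩
      (sum λ i → sum λ l → normal h i * projection i l * z l)
        ≈⟨ sum-cong (λ i → sum-cong λ l → *-assoc (normal h i) (projection i l) (z l)) ⟩
      (sum λ i → sum λ l → normal h i * (projection i l * z l))
        ≈⟨ sum-cong (λ i → *-distribˡ-sum (normal h i) (λ l → projection i l * z l)) ⟨
      (sum λ i → normal h i * (projection i ∙ z)) ∎))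
    decomp : ∀ a → Σ[ c ∈ (Fin k → Carrier) ] ((∀ i → 0# ≤ c i) ×
        (∀ {z} → z ∈ ⟦ Q ⟧ → slack (pullback (h a)) z ≈ sum λ i → c i * slack (enum facets i) z))
    decomp a = facetDecomposition facets λ {z} z∈Q → 0≤y-x⇒x≤y (≤-trans
      (0≤y-x (valid a (proj₂ image (z , z∈Q , λ i → refl))))
      (≤-reflexive (sym (slack-pullback (h a) z))))

-- Polygons with vertices on the parabola.

module ParabolaPolygon (em : ExcludedMiddle 0ℓ) (ℝ : CompleteOrderedField) where
  open OrderedField em ℝ
  open Classical em
  open Faces em ℝ
  open Polytopes ℝ hiding (sum)
  open Polytope
  open _∈conv_
  open Inequality

  -- Some generator has nonzero weight in `v`; it lies on the exposing face, which is `v` alone.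
  vertex⇒generator : ∀ {d} {P : Polytope d} {v} → IsVertex P v → ∃[ j ] generator P j ≋ v
  vertex⇒generator {P = P} {v} (h , valid , face⊆ , face⊇) =
    let j , w≉0 = some-weight
    in j , face⊆ (generator∈face h (*-cancelˡ-≈0 w≉0 (weight*slack≈0 {P = P} {h} valid v∈face j)))
    where
    v∈face : v ∈ face P h
    v∈face = face⊇ (λ i → refl)
    some-weight : ∃[ j ] ¬ weight (proj₁ v∈face) j ≈ 0#
    some-weight = ¬¬-elim λ none → 0≉1 (trans
      (sym (sum-zero {f = weight (proj₁ v∈face)} λ j → ¬¬-elim λ w≉0 → none (j , w≉0)))
      (sum≈1 (proj₁ v∈face)))

  uniquelyTight⇒vertex : ∀ {d} {P : Polytope d} {h} i → Valid P h → slackVector {P = P} h i ≈ 0# →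
    (∀ j → ¬ j ≡ i → ¬ slackVector {P = P} h j ≈ 0#) → IsVertex P (generator P i)
  uniquelyTight⇒vertex {P = P} {h} i valid zᵢ nz = h , valid ,
    (λ {x} x∈F@(x∈P , _) → only-i x∈P (weight*slack≈0 {P = P} {h} valid x∈F)) ,
    λ x≋gᵢ → ∈conv-resp-≋ (λ l → sym (x≋gᵢ l)) (generator∈ P i) ,
             slack≈0⇒tight h (trans (slack-cong h x≋gᵢ) zᵢ)
    where
    only-i : ∀ {x} (x∈P : x ∈ ⟦ P ⟧) → (∀ j → weight x∈P j * slackVector {P = P} h j ≈ 0#) → x ≋ generator P i
    only-i {x} x∈P ws≈0 l = begin-equality
      x l
        ≈⟨ combine x∈P l ⟩
      (sum λ j → w j * generator P j l)
        ≈⟨ sum-single i (λ j j≢i → trans (*-congʳ (w≈0 j j≢i)) (zeroˡ _)) ⟩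
      w i * generator P i l
        ≈⟨ *-congʳ (trans (sym (sum-single i w≈0)) (sum≈1 x∈P)) ⟩
      1# * generator P i l
        ≈⟨ *-identityˡ _ ⟩
      generator P i l ∎
      where
      w = weight x∈P
      w≈0 : ∀ j → ¬ j ≡ i → w j ≈ 0#
      w≈0 j j≢i = *-cancelˡ-≈0 (nz j j≢i) (trans (*-comm _ _) (ws≈0 j))

  parabola : ℕ → Point 2
  parabola a zero       = fromℕ a
  parabola a (suc zero) = fromℕ (a ℕ.* a)

  polygon : ∀ {n} → (Fin n → ℕ) → Polytope 2
  polygon x = record { generator = λ i → parabola (x i) }

  sqDist : ℕ → ℕ → Carrier
  sqDist a b = (fromℕ a - fromℕ b) * (fromℕ a - fromℕ b)

  -- On the parabola it reads  c ≤ (x − y)².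
  apart : ℕ → Carrier → Inequality 2
  apart y c = record
    { normal = λ { zero → fromℕ y + fromℕ y ; (suc zero) → - 1# }
    ; bound  = fromℕ y * fromℕ y - c
    }

  slack-apart : ∀ y c x → slack (apart y c) (parabola x) ≈ sqDist x y - c
  slack-apart y c x = begin-equality
    fromℕ y * fromℕ y - c - ((fromℕ y + fromℕ y) * fromℕ x + (- 1# * fromℕ (x ℕ.* x) + 0#))
      ≈⟨ +-congˡ (-‿cong (+-congˡ (+-congʳ (*-congˡ (fromℕ-* x x))))) ⟩
    fromℕ y * fromℕ y - c - ((fromℕ y + fromℕ y) * fromℕ x + (- 1# * (fromℕ x * fromℕ x) + 0#))
      ≈⟨ solve 3 (λ x y c → y :* y :- c :- ((y :+ y) :* x :+ (:- con (+ 1) :* (x :* x) :+ con (+ 0)))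
                              := (x :- y) :* (x :- y) :- c) refl (fromℕ x) (fromℕ y) c ⟩
    sqDist x y - c ∎

  sqDist-comm : ∀ a b → sqDist a b ≈ sqDist b a
  sqDist-comm a b = solve 2 (λ a b → (a :- b) :* (a :- b) := (b :- a) :* (b :- a)) refl (fromℕ a) (fromℕ b)

  -- With a = d + b + e the right side is (d + e)², where d and e are nonnegative.
  sqDist-gap : ∀ d {a b} → d ℕ.+ b ℕ.≤ a → fromℕ d * fromℕ d ≤ sqDist a b
  sqDist-gap d {a} {b} d+b≤a = begin
    D * D
      ≤⟨ x≤x+y (+-nonNeg (*-nonNeg (+-nonNeg 0≤D 0≤D) (fromℕ-nonNeg e)) (square-nonNeg E)) ⟩
    D * D + ((D + D) * E + E * E)
      ≈⟨ solve 3 (λ d e b → d :* d :+ ((d :+ d) :* e :+ e :* e) := (d :+ b :+ e :- b) :* (d :+ b :+ e :- b))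
           refl D E (fromℕ b) ⟩
    (D + fromℕ b + E - fromℕ b) * (D + fromℕ b + E - fromℕ b)
      ≈⟨ *-cong a-b a-b ⟨
    sqDist a b ∎
    where
    e = a ℕ.∸ (d ℕ.+ b)
    D = fromℕ d
    E = fromℕ e
    0≤D : 0# ≤ D
    0≤D = fromℕ-nonNeg d
    a-b : fromℕ a - fromℕ b ≈ D + fromℕ b + E - fromℕ b
    a-b = +-congʳ (begin-equality
      fromℕ a                      ≡⟨ ≡.cong fromℕ (≡.sym (ℕ.m+[n∸m]≡n d+b≤a)) ⟩
      fromℕ (d ℕ.+ b ℕ.+ e)        ≈⟨ fromℕ-+ (d ℕ.+ b) e ⟩
      fromℕ (d ℕ.+ b) + E          ≈⟨ +-congʳ (fromℕ-+ d b) ⟩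
      D + fromℕ b + E              ∎)

  1≤sqDist : ∀ {a b} → ¬ a ≡ b → 1# ≤ sqDist a b
  1≤sqDist {a} {b} a≢b = ≤-trans (≤-reflexive 1≈1*1) (gap (ℕ.<-cmp a b))
    where
    1≈1*1 : 1# ≈ fromℕ 1 * fromℕ 1
    1≈1*1 = sym (trans (*-cong fromℕ-1 fromℕ-1) (*-identityˡ 1#))
    gap : Tri (a ℕ.< b) (a ≡ b) (b ℕ.< a) → fromℕ 1 * fromℕ 1 ≤ sqDist a b
    gap (tri< a<b _ _) = ≤-trans (sqDist-gap 1 a<b) (≤-reflexive (sqDist-comm b a))
    gap (tri≈ _ a≡b _) = contradiction a≡b a≢b
    gap (tri> _ _ b<a) = sqDist-gap 1 b<a

  module _ {n} (x : Fin n → ℕ) where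

    apart-valid : ∀ {y} c → (∀ i → c ≤ sqDist (x i) y) → Valid (polygon x) (apart y c)
    apart-valid {y} c p = valid⁺ {P = polygon x} {apart y c} λ i → ≤-trans (0≤y-x (p i)) (≤-reflexive (sym (slack-apart y c (x i))))

    -- Each point is exposed by the tangent to the parabola there, `apart (x i) 0#`, whose slack at
    -- the other points is a nonzero square.
    hasVertexCount : Injective _≡_ _≡_ x → HasVertexCount (polygon x) n
    hasVertexCount x-inj = record
      { enum      = generator (polygon x)
      ; sound     = sound
      ; injective = λ eq → x-inj (fromℕ-injective (eq zero))
      ; complete  = vertex⇒generator
      }
      where
      slack≈ : ∀ i j → slackVector {P = polygon x} (apart (x i) 0#) j ≈ sqDist (x j) (x i)
      slack≈ i j = trans (slack-apart (x i) 0# (x j)) (solve 1 (λ a → a :- con (+ 0) := a) refl _)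
      sound : ∀ i → IsVertex (polygon x) (parabola (x i))
      sound i = uniquelyTight⇒vertex {P = polygon x} {apart (x i) 0#} i
        (apart-valid {x i} 0# (λ j → square-nonNeg _))
        (trans (slack≈ i i) (solve 1 (λ a → (a :- a) :* (a :- a) := con (+ 0)) refl (fromℕ (x i))))
        (λ j j≢i z → 1≰0 (≤-trans (1≤sqDist (λ eq → j≢i (x-inj eq)))
                          (≤-reflexive (trans (sym (slack≈ i j)) z))))

    isConvexGon : 3 ℕ.≤ n → Injective _≡_ _≡_ x → IsConvexGon n (polygon x)
    isConvexGon 3≤n x-inj = 3≤n , hasVertexCount x-inj

    vertices-inGrid : (∀ i → 1 ℕ.≤ x i × x i ℕ.≤ 2 ℕ.* n) →
                      ∀ {v} → IsVertex (polygon x) v → InGrid (2 ℕ.* n) (4 ℕ.* n ℕ.^ 2) v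
    vertices-inGrid bounds {v} vertex =
      let i , eq = vertex⇒generator {P = polygon x} vertex
          1≤xᵢ , xᵢ≤2n = bounds i
      in x i , x i ℕ.* x i , (1≤xᵢ , xᵢ≤2n) ,
         (ℕ.*-mono-≤ 1≤xᵢ 1≤xᵢ , ℕ.≤-trans (ℕ.*-mono-≤ xᵢ≤2n xᵢ≤2n) (ℕ.≤-reflexive (square-2n n))) ,
         sym (eq zero) , sym (eq (suc zero))
      where
      square-2n : ∀ n → (2 ℕ.* n) ℕ.* (2 ℕ.* n) ≡ 4 ℕ.* (n ℕ.* (n ℕ.* 1))
      square-2n = solve-∀

-- Nonnegative factorisations and how two of them are compared.

module Factorizations (em : ExcludedMiddle 0ℓ) (ℝ : CompleteOrderedField) where
  open OrderedField em ℝ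
  open Faces em ℝ
  open FacetDecomposition em ℝ
  open ParabolaPolygon em ℝ
  open Spanner em ℝ
  open Polytopes ℝ using (Inequality; HasExtensionOfSize)

  record Factorization (k : ℕ) {m n} (y : Fin m → ℕ) (x : Fin n → ℕ) : Set where
    field
      u        : Fin m → Fin k → Carrier
      v        : Fin n → Fin k → Carrier
      u-nonNeg : ∀ a i → 0# ≤ u a i
      v-nonNeg : ∀ b i → 0# ≤ v b i
      product  : ∀ a b → (sum λ i → u a i * v b i) ≈ sqDist (x b) (y a) - 1#

  open Factorization

  extension⇒factorization : ∀ {k m n} {y : Fin m → ℕ} {x : Fin n → ℕ} → (∀ a b → ¬ x b ≡ y a) →
                            HasExtensionOfSize (polygon x) k → Factorization k y x
  extension⇒factorization {y = y} {x} x≢y ext =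
    let u , v , 0≤u , 0≤v , eq = slackFactorization ext (λ a → apart (y a) 1#) (λ b → parabola (x b))
          (λ a → apart-valid x {y a} 1# (λ b → 1≤sqDist (x≢y a b)))
          (generator∈ (polygon x))
    in record
      { u = u ; v = v ; u-nonNeg = 0≤u ; v-nonNeg = 0≤v
      ; product = λ a b → trans (sym (eq a b)) (slack-apart (y a) 1# (x b))
      }

  0∷_ : ∀ {k} → (Fin k → Carrier) → Fin (suc k) → Carrier
  (0∷ w) zero    = 0#
  (0∷ w) (suc i) = w i

  0∷-nonNeg : ∀ {k} {w : Fin k → Carrier} → (∀ i → 0# ≤ w i) → ∀ i → 0# ≤ (0∷ w) i
  0∷-nonNeg p zero    = ≤-refl
  0∷-nonNeg p (suc i) = p i

  -- The polygons differ in extension complexity, but a common code format needs one inner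
  -- dimension; zero entries supply it.
  pad : ∀ {k k′ m n} {y : Fin m → ℕ} {x : Fin n → ℕ} → k ℕ.≤′ k′ → Factorization k y x → Factorization k′ y x
  pad (ℕ.≤′-reflexive ≡.refl) F = F
  pad (ℕ.≤′-step k≤k′)        F = let G = pad k≤k′ F in record
    { u = λ a → 0∷ u G a
    ; v = λ b → 0∷ v G b
    ; u-nonNeg = λ a → 0∷-nonNeg (u-nonNeg G a)
    ; v-nonNeg = λ b → 0∷-nonNeg (v-nonNeg G b)
    ; product  = λ a b → trans (trans (+-congʳ (zeroˡ 0#)) (+-identityˡ _)) (product G a b)
    }

  record Bounded (Δ : ℕ) {k m n} {y : Fin m → ℕ} {x : Fin n → ℕ} (F : Factorization k y x) : Set where
    field
      u≤1 : ∀ a i → u F a i ≤ 1#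
      v≤Δ : ∀ b i → v F b i ≤ fromℕ Δ

  open Bounded

  -- Move the maximum M of `u` into `v`: then `M * v b` is itself one of the products bounded by
  -- `Δ`. If M is 0, all products vanish and zeros serve on both sides.
  rescale : ∀ {m n} Δ (u : Fin (suc m) → Carrier) (v : Fin n → Carrier) →
    (∀ a → 0# ≤ u a) → (∀ b → 0# ≤ v b) → 0# ≤ Δ → (∀ a b → u a * v b ≤ Δ) →
    Σ[ u′ ∈ (Fin (suc m) → Carrier) ] Σ[ v′ ∈ (Fin n → Carrier) ]
      ((∀ a → 0# ≤ u′ a × u′ a ≤ 1#) × (∀ b → 0# ≤ v′ b × v′ b ≤ Δ) × (∀ a b → u′ a * v′ b ≈ u a * v b))
  rescale Δ u v 0≤u 0≤v 0≤Δ uv≤Δ = split em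
    where
    top = argmax u
    M = u (proj₁ top)
    split : Dec (M ≈ 0#) → _
    split (yes M≈0) = (λ _ → 0#) , (λ _ → 0#) , (λ _ → ≤-refl , 0≤1) , (λ _ → ≤-refl , 0≤Δ) , λ a b →
      trans (zeroˡ 0#) (sym (trans (*-congʳ (≤-antisym (≤-trans (proj₂ top a) (≤-reflexive M≈0)) (0≤u a))) (zeroˡ (v b))))
    split (no M≉0) = (λ a → M ⁻¹ * u a) , (λ b → M * v b) ,
      (λ a → *-nonNeg 0≤M⁻¹ (0≤u a) ,
             ≤-trans (*-monoˡ-≤ 0≤M⁻¹ (proj₂ top a)) (≤-reflexive (trans (*-comm _ _) (*-inverseʳ M≉0)))) ,
      (λ b → *-nonNeg (0≤u _) (0≤v b) , uv≤Δ _ b) ,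
      λ a b → begin-equality
        M ⁻¹ * u a * (M * v b)    ≈⟨ solve 4 (λ i u m v → i :* u :* (m :* v) := m :* i :* (u :* v)) refl (M ⁻¹) (u a) M (v b) ⟩
        M * M ⁻¹ * (u a * v b)    ≈⟨ *-congʳ (*-inverseʳ M≉0) ⟩
        1# * (u a * v b)          ≈⟨ *-identityˡ _ ⟩
        u a * v b                 ∎
      where
      0≤M⁻¹ : 0# ≤ M ⁻¹
      0≤M⁻¹ = ⁻¹-nonNeg (0≤u (proj₁ top)) M≉0

  -- A nonnegative summand is at most the whole entry, so each inner index can be rescaled on its
  -- own.
  normalise : ∀ {k m n} {y : Fin (suc m) → ℕ} {x : Fin n → ℕ} Δ → (∀ a b → sqDist (x b) (y a) ≤ fromℕ Δ) →
              Factorization k y x → ∃ (Bounded Δ {k} {suc m} {n} {y} {x})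
  normalise {k} {y = y} {x} Δ dist≤Δ F = G , record
    { u≤1 = λ a i → proj₂ (proj₁ (proj₂ (proj₂ (column i))) a)
    ; v≤Δ = λ b i → proj₂ (proj₁ (proj₂ (proj₂ (proj₂ (column i)))) b)
    }
    where
    entry≤Δ : ∀ i a b → u F a i * v F b i ≤ fromℕ Δ
    entry≤Δ i a b = begin
      u F a i * v F b i                     ≤⟨ term≤sum (λ j → *-nonNeg (u-nonNeg F a j) (v-nonNeg F b j)) i ⟩
      (sum λ j → u F a j * v F b j)         ≈⟨ product F a b ⟩
      sqDist (x b) (y a) - 1#               ≤⟨ x≤x+y 0≤1 ⟩
      sqDist (x b) (y a) - 1# + 1#          ≈⟨ solve 2 (λ s o → s :- o :+ o := s) refl (sqDist (x b) (y a)) 1# ⟩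
      sqDist (x b) (y a)                    ≤⟨ dist≤Δ a b ⟩
      fromℕ Δ                               ∎
    column = λ i → rescale (fromℕ Δ) (λ a → u F a i) (λ b → v F b i)
      (λ a → u-nonNeg F a i) (λ b → v-nonNeg F b i) (fromℕ-nonNeg Δ) (entry≤Δ i)
    G : Factorization k y x
    G = record
      { u = λ a i → proj₁ (column i) a
      ; v = λ b i → proj₁ (proj₂ (column i)) b
      ; u-nonNeg = λ a i → proj₁ (proj₁ (proj₂ (proj₂ (column i))) a)
      ; v-nonNeg = λ b i → proj₁ (proj₁ (proj₂ (proj₂ (proj₂ (column i)))) b)
      ; product  = λ a b → trans (sum-cong λ i → proj₂ (proj₂ (proj₂ (proj₂ (column i)))) a b) (product F a b)
      }

  -- For fixed x, (x - y)² - 1 is a combination of 1, y and y². Coefficients that express one row by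
  -- others therefore also transfer this value, even at an x that is no vertex of this polygon.
  rowData : ∀ {k m n} {y : Fin m → ℕ} {x : Fin n → ℕ} → Factorization k y x → Fin (3 ℕ.+ k) → Fin m → Carrier
  rowData         F zero                a = 1#
  rowData {y = y} F (suc zero)          a = fromℕ (y a)
  rowData {y = y} F (suc (suc zero))    a = fromℕ (y a) * fromℕ (y a)
  rowData         F (suc (suc (suc i))) a = u F a i

  *-≤∣∣-unit : ∀ {c e b} → c ≤∣ 1# ∣ → e ≤∣ b ∣ → 0# ≤ b → c * e ≤ b
  *-≤∣∣-unit {c} {e} {b} (-1≤c , c≤1) (-b≤e , e≤b) 0≤b = bound (≤-total 0# c)
    where
    bound : 0# ≤ c ⊎ c ≤ 0# → c * e ≤ b
    bound (inj₁ 0≤c) = ≤-trans (*-mono-≤ 0≤c 0≤b c≤1 e≤b) (≤-reflexive (*-identityˡ b))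
    bound (inj₂ c≤0) = begin
      c * e          ≈⟨ solve 2 (λ c e → c :* e := :- c :* :- e) refl c e ⟩
      - c * - e      ≤⟨ *-mono-≤ (x≤0⇒0≤-x c≤0) 0≤b -c≤1 (proj₂ (neg-≤∣∣ (-b≤e , e≤b))) ⟩
      1# * b         ≈⟨ *-identityˡ b ⟩
      b              ∎
      where
      -c≤1 : - c ≤ 1#
      -c≤1 = proj₂ (neg-≤∣∣ (-1≤c , c≤1))

  -- Suppose the number y a, which the first polygon avoids, is the vertex
  -- x′ b of the second.  Expanding row a of the first factorisation along
  -- the spanning rows, which nearly agree with rows of the second one,
  -- gives 0 ≤ u a · v′ b ≈ (y a − x′ b)² − 1 = −1.
  distinguished : ∀ {k m m′ n n′} {y : Fin m → ℕ} {x : Fin n → ℕ} {y′ : Fin m′ → ℕ} {x′ : Fin n′ → ℕ} {Δ K}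
    (F : Factorization k y x) (F′ : Factorization k y′ x′) → Bounded Δ F′ →
    ((β , _) : Spans (rowData F) (3 ℕ.+ k)) (β′ : Fin (3 ℕ.+ k) → Fin m′) →
    (∀ j → y (β j) ≡ y′ (β′ j)) →
    (∀ j i → fromℕ K * (u F (β j) i - u F′ (β′ j) i) ≤∣ 1# ∣) →
    ∀ a b → x′ b ≡ y a → K ℕ.≤ (3 ℕ.+ k) ℕ.* (k ℕ.* Δ)
  distinguished {k} {y = y} {x} {y′} {x′} {Δ} {K} F F′ bd (β , span) β′ same-y near a b x′b≡ya =
    fromℕ-cancel-≤ (begin
      κ
        ≈⟨ solve 1 (λ κ → κ := κ :+ con (+ 0)) refl κ ⟩
      κ + 0#
        ≤⟨ +-monoʳ-≤ κ (*-nonNeg (fromℕ-nonNeg K) 0≤Q) ⟩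
      κ + κ * Q
        ≈⟨ +-congˡ (*-congˡ Q≈) ⟩
      κ + κ * (sum λ j → c j * q j)
        -- Replacing the rows by those of the second factorisation isolates the rounding error; the
        -- remaining bracket is 1 + (-1). Scaling by K avoids division.
        ≈⟨ solve 3 (λ κ s t → κ :+ κ :* s := κ :* (s :- t) :+ κ :* (con (+ 1) :+ t)) refl κ _ (sum λ j → c j * q′ j) ⟩
      κ * ((sum λ j → c j * q j) - (sum λ j → c j * q′ j)) + κ * (1# + (sum λ j → c j * q′ j))
        ≈⟨ +-cong errors (*-congˡ (trans (+-congˡ q′-sum) (-‿inverseʳ 1#))) ⟩
      (sum λ j → c j * (κ * (q j - q′ j))) + κ * 0#
        ≈⟨ solve 2 (λ s κ → s :+ κ :* con (+ 0) := s) refl _ κ ⟩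
      (sum λ j → c j * (κ * (q j - q′ j)))
        ≤⟨ sum-≤-const B (λ j → *-≤∣∣-unit (proj₁ (proj₂ (span a)) j) (q-near j) 0≤B) ⟩
      fromℕ (3 ℕ.+ k) * B
        ≈⟨ *-congˡ (fromℕ-* k Δ) ⟨
      fromℕ (3 ℕ.+ k) * fromℕ (k ℕ.* Δ)
        ≈⟨ fromℕ-* (3 ℕ.+ k) (k ℕ.* Δ) ⟨
      fromℕ ((3 ℕ.+ k) ℕ.* (k ℕ.* Δ)) ∎)
    where
    κ = fromℕ K
    B = fromℕ k * fromℕ Δ
    0≤B : 0# ≤ B
    0≤B = *-nonNeg (fromℕ-nonNeg k) (fromℕ-nonNeg Δ)
    c = proj₁ (span a)
    expand : ∀ i → rowData F i a ≈ sum λ j → c j * rowData F i (β j)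
    expand = proj₂ (proj₂ (span a))
    w = v F′ b
    Q = sum λ i → u F a i * w i
    q q′ : Fin (3 ℕ.+ k) → Carrier
    q  j = sum λ i → u F (β j) i * w i
    q′ j = sum λ i → u F′ (β′ j) i * w i
    0≤Q : 0# ≤ Q
    0≤Q = sum-nonNeg λ i → *-nonNeg (u-nonNeg F a i) (v-nonNeg F′ b i)

    Q≈ : Q ≈ sum λ j → c j * q j
    Q≈ = begin-equality
      (sum λ i → u F a i * w i)
        ≈⟨ sum-cong (λ i → trans (*-congʳ (expand (suc (suc (suc i))))) (*-distribʳ-sum (w i) (λ j → c j * u F (β j) i))) ⟩
      (sum λ i → sum λ j → c j * u F (β j) i * w i)
        ≈⟨ ∑-comm (λ i j → c j * u F (β j) i * w i) ⟩
      (sum λ j → sum λ i → c j * u F (β j) i * w i)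
        ≈⟨ sum-cong (λ j → sum-cong λ i → *-assoc (c j) (u F (β j) i) (w i)) ⟩
      (sum λ j → sum λ i → c j * (u F (β j) i * w i))
        ≈⟨ sum-cong (λ j → *-distribˡ-sum (c j) (λ i → u F (β j) i * w i)) ⟨
      (sum λ j → c j * q j) ∎

    errors : κ * ((sum λ j → c j * q j) - (sum λ j → c j * q′ j)) ≈ sum λ j → c j * (κ * (q j - q′ j))
    errors = begin-equality
      κ * ((sum λ j → c j * q j) - (sum λ j → c j * q′ j))
        ≈⟨ *-congˡ (sum-sub (λ j → c j * q j) (λ j → c j * q′ j)) ⟨
      κ * (sum λ j → c j * q j - c j * q′ j)
        ≈⟨ *-distribˡ-sum κ (λ j → c j * q j - c j * q′ j) ⟩
      (sum λ j → κ * (c j * q j - c j * q′ j))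
        ≈⟨ sum-cong (λ j → solve 4 (λ κ c q r → κ :* (c :* q :- c :* r) := c :* (κ :* (q :- r))) refl κ (c j) (q j) (q′ j)) ⟩
      (sum λ j → c j * (κ * (q j - q′ j))) ∎

    X = fromℕ (y a)
    Y : Fin (3 ℕ.+ k) → Carrier
    Y j = fromℕ (y (β j))

    q′≈ : ∀ j → q′ j ≈ (X - Y j) * (X - Y j) - 1#
    q′≈ j = trans (product F′ (β′ j) b) (reflexive (≡.cong₂ (λ s t → sqDist s t - 1#) x′b≡ya (≡.sym (same-y j))))

    -- The first three columns of `rowData` make `c` reproduce (X - y)² - 1 at y = `y a`, which is X
    -- itself.
    q′-sum : (sum λ j → c j * q′ j) ≈ - 1#
    q′-sum = begin-equality
      (sum λ j → c j * q′ j)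
        ≈⟨ sum-cong (λ j → trans (*-congˡ (q′≈ j))
             (solve 3 (λ c x y → c :* ((x :- y) :* (x :- y) :- con (+ 1))
                         := (x :* x :- con (+ 1)) :* (c :* con (+ 1)) :- ((x :+ x) :* (c :* y) :- c :* (y :* y)))
               refl (c j) X (Y j))) ⟩
      (sum λ j → (X * X - 1#) * (c j * 1#) - ((X + X) * (c j * Y j) - c j * (Y j * Y j)))
        ≈⟨ trans (sum-sub (λ j → (X * X - 1#) * (c j * 1#)) (λ j → (X + X) * (c j * Y j) - c j * (Y j * Y j)))
             (+-congˡ (-‿cong (sum-sub (λ j → (X + X) * (c j * Y j)) (λ j → c j * (Y j * Y j))))) ⟩
      (sum λ j → (X * X - 1#) * (c j * 1#)) - ((sum λ j → (X + X) * (c j * Y j)) - (sum λ j → c j * (Y j * Y j)))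
        ≈⟨ +-cong (*-distribˡ-sum (X * X - 1#) (λ j → c j * 1#))
                  (-‿cong (+-congʳ (*-distribˡ-sum (X + X) (λ j → c j * Y j)))) ⟨
      (X * X - 1#) * (sum λ j → c j * 1#) - ((X + X) * (sum λ j → c j * Y j) - (sum λ j → c j * (Y j * Y j)))
        ≈⟨ +-cong (*-congˡ (expand zero))
                  (-‿cong (+-cong (*-congˡ (expand (suc zero))) (-‿cong (expand (suc (suc zero)))))) ⟨
      (X * X - 1#) * 1# - ((X + X) * X - X * X)
        ≈⟨ solve 1 (λ x → (x :* x :- con (+ 1)) :* con (+ 1) :- ((x :+ x) :* x :- x :* x) := :- con (+ 1)) refl X ⟩
      - 1# ∎

    -- There are k coordinates, each with scaled error at most 1 against an entry of V at most `Δ`.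
    q-near : ∀ j → κ * (q j - q′ j) ≤∣ B ∣
    q-near j = ≤∣∣-resp (sym scaled) refl
      (lower , sum-≤-const (fromℕ Δ) (λ i → *-≤∣∣-unit′ i (near j i)))
      where
      e : Fin k → Carrier
      e i = κ * (u F (β j) i - u F′ (β′ j) i)
      scaled : κ * (q j - q′ j) ≈ sum λ i → e i * w i
      scaled = begin-equality
        κ * (q j - q′ j)
          ≈⟨ *-congˡ (sum-sub (λ i → u F (β j) i * w i) (λ i → u F′ (β′ j) i * w i)) ⟨
        κ * (sum λ i → u F (β j) i * w i - u F′ (β′ j) i * w i)
          ≈⟨ *-distribˡ-sum κ (λ i → u F (β j) i * w i - u F′ (β′ j) i * w i) ⟩
        (sum λ i → κ * (u F (β j) i * w i - u F′ (β′ j) i * w i))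
          ≈⟨ sum-cong (λ i → solve 4 (λ κ s t w → κ :* (s :* w :- t :* w) := κ :* (s :- t) :* w) refl
                               κ (u F (β j) i) (u F′ (β′ j) i) (w i)) ⟩
        (sum λ i → e i * w i) ∎
      w-bd : ∀ i → w i ≤∣ fromℕ Δ ∣
      w-bd i = ≤-trans (neg-antimono-≤ (fromℕ-nonNeg Δ)) (≤-trans (≤-reflexive -0#≈0#) (v-nonNeg F′ b i)) , v≤Δ bd b i
      *-≤∣∣-unit′ : ∀ i {s} → s ≤∣ 1# ∣ → s * w i ≤ fromℕ Δ
      *-≤∣∣-unit′ i s-bd = *-≤∣∣-unit s-bd (w-bd i) (fromℕ-nonNeg Δ)
      lower : - B ≤ sum λ i → e i * w i
      lower = ≤-trans
        (neg-antimono-≤ (sum-≤-const (fromℕ Δ) (λ i → *-≤∣∣-unit′ i (neg-≤∣∣ (near j i)))))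
        (≤-reflexive (trans (sym (sum-neg (λ i → - e i * w i)))
          (sum-cong λ i → solve 2 (λ e w → :- (:- e :* w) := e :* w) refl (e i) (w i))))

-- Encoding transversals by rounded spanning rows.

module Counting (em : ExcludedMiddle 0ℓ) (ℝ : CompleteOrderedField) where
  open Arithmetic using (slackBound; resolution; codeBound)
  open OrderedField em ℝ
  open Classical em
  open ParabolaPolygon em ℝ
  open Spanner em ℝ
  open Factorizations em ℝ
  open Factorization
  open Bounded

  -- Recursion on `K` in place of a floor function. At an integer, `t` may be that integer or the
  -- one before; only the unit interval matters.
  roundDown : ∀ K {r} → 0# ≤ r → r ≤ fromℕ K →
              Σ[ t ∈ Fin (suc K) ] (fromℕ (Fin.toℕ t) ≤ r × r ≤ 1# + fromℕ (Fin.toℕ t))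
  roundDown zero    0≤r r≤K = zero , 0≤r , ≤-trans r≤K (+-nonNeg 0≤1 ≤-refl)
  roundDown (suc K) {r} 0≤r r≤K = split (≤-total r (fromℕ K))
    where
    split : r ≤ fromℕ K ⊎ fromℕ K ≤ r → _
    split (inj₁ r≤K′) = let t , lower , upper = roundDown K 0≤r r≤K′ in
      Fin.inject₁ t ,
      ≤-trans (≤-reflexive (reflexive (≡.cong fromℕ (Fin.toℕ-inject₁ t)))) lower ,
      ≤-trans upper (≤-reflexive (reflexive (≡.cong (λ s → 1# + fromℕ s) (≡.sym (Fin.toℕ-inject₁ t)))))
    split (inj₂ K≤r) = Fin.inject₁ (Fin.fromℕ K) ,
      ≤-trans (≤-reflexive (reflexive (≡.cong fromℕ K≡))) K≤r ,
      ≤-trans r≤K (≤-reflexive (reflexive (≡.cong (λ s → 1# + fromℕ s) (≡.sym K≡))))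
      where
      K≡ : Fin.toℕ (Fin.inject₁ (Fin.fromℕ K)) ≡ K
      K≡ = ≡.trans (Fin.toℕ-inject₁ (Fin.fromℕ K)) (Fin.toℕ-fromℕ K)

  within-one : ∀ {r s t} → t ≤ r → r ≤ 1# + t → t ≤ s → s ≤ 1# + t → r - s ≤∣ 1# ∣
  within-one {r} {s} {t} t≤r r≤1+t t≤s s≤1+t =
    ≤-trans (≤-reflexive (solve 2 (λ o t → :- o := t :- (o :+ t)) refl 1# t)) (+-mono-≤ t≤r (neg-antimono-≤ s≤1+t)) ,
    ≤-trans (+-mono-≤ r≤1+t (neg-antimono-≤ t≤s)) (≤-reflexive (solve 2 (λ o t → o :+ t :- t := o) refl 1# t))

  sqDist-≤ : ∀ {a b c} → a ℕ.≤ c → b ℕ.≤ c → sqDist a b ≤ fromℕ (c ℕ.* c ℕ.+ c ℕ.* c)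
  sqDist-≤ {a} {b} {c} a≤c b≤c = begin
    sqDist a b
      ≤⟨ x≤x+y (+-nonNeg 0≤ab 0≤ab) ⟩
    sqDist a b + (fromℕ a * fromℕ b + fromℕ a * fromℕ b)
      ≈⟨ solve 2 (λ a b → (a :- b) :* (a :- b) :+ (a :* b :+ a :* b) := a :* a :+ b :* b) refl (fromℕ a) (fromℕ b) ⟩
    fromℕ a * fromℕ a + fromℕ b * fromℕ b
      ≈⟨ +-cong (fromℕ-* a a) (fromℕ-* b b) ⟨
    fromℕ (a ℕ.* a) + fromℕ (b ℕ.* b)
      ≈⟨ fromℕ-+ (a ℕ.* a) (b ℕ.* b) ⟨
    fromℕ (a ℕ.* a ℕ.+ b ℕ.* b)
      ≤⟨ fromℕ-mono (ℕ.+-mono-≤ (ℕ.*-mono-≤ a≤c a≤c) (ℕ.*-mono-≤ b≤c b≤c)) ⟩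
    fromℕ (c ℕ.* c ℕ.+ c ℕ.* c) ∎
    where
    0≤ab : 0# ≤ fromℕ a * fromℕ b
    0≤ab = *-nonNeg (fromℕ-nonNeg a) (fromℕ-nonNeg b)

  -- [2n] splits into the n pairs {2i + 1, 2i + 2}; a choice function f
  -- selects one element of each pair.
  element : ∀ {n} → Fin n → Fin 2 → ℕ
  element i b = suc (Fin.toℕ (Fin.combine i b))

  chosen rejected : ∀ {n} → (Fin n → Fin 2) → Fin n → ℕ
  chosen   f i = element i (f i)
  rejected f i = element i (Fin.opposite (f i))

  element-injective : ∀ {n} {i j : Fin n} {b c} → element i b ≡ element j c → i ≡ j × b ≡ c
  element-injective {i = i} {j} {b} {c} eq =
    Fin.combine-injective i b j c (Fin.toℕ-injective (ℕ.suc-injective eq))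

  element≤2n : ∀ {n} (i : Fin n) b → element i b ℕ.≤ n ℕ.* 2
  element≤2n i b = Fin.toℕ<n (Fin.combine i b)

  chosen-injective : ∀ {n} (f : Fin n → Fin 2) → Injective _≡_ _≡_ (chosen f)
  chosen-injective f eq = proj₁ (element-injective eq)

  opposite≢ : ∀ (b : Fin 2) → ¬ b ≡ Fin.opposite b
  opposite≢ zero       ()
  opposite≢ (suc zero) ()

  ≢⇒opposite : ∀ {b c : Fin 2} → ¬ b ≡ c → c ≡ Fin.opposite b
  ≢⇒opposite {zero}     {zero}     b≢c = contradiction ≡.refl b≢c
  ≢⇒opposite {zero}     {suc zero} b≢c = ≡.refl
  ≢⇒opposite {suc zero} {zero}     b≢c = ≡.refl
  ≢⇒opposite {suc zero} {suc zero} b≢c = contradiction ≡.refl b≢c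

  chosen≢rejected : ∀ {n} (f : Fin n → Fin 2) a b → ¬ chosen f b ≡ rejected f a
  chosen≢rejected f a b eq = separate (element-injective eq)
    where
    separate : ¬ (b ≡ a × f b ≡ Fin.opposite (f a))
    separate (≡.refl , p) = opposite≢ (f a) p

  funToFin-cong : ∀ {m n} {f g : Fin m → Fin n} → (∀ i → f i ≡ g i) → Fin.funToFin f ≡ Fin.funToFin g
  funToFin-cong {zero}  p = ≡.refl
  funToFin-cong {suc m} p = ≡.cong₂ Fin.combine (p zero) (funToFin-cong (λ i → p (suc i)))

  funToFin-injective : ∀ {m n} {f g : Fin m → Fin n} → Fin.funToFin f ≡ Fin.funToFin g → ∀ i → f i ≡ g i
  funToFin-injective {f = f} {g} eq i = ≡.trans (≡.sym (Fin.finToFun-funToFin f i))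
    (≡.trans (≡.cong (λ t → Fin.finToFun t i) eq) (Fin.finToFun-funToFin g i))

  module _ {n k} (fac : ∀ p → Factorization k (rejected (Fin.finToFun {2} {suc n} p)) (chosen (Fin.finToFun {2} {suc n} p))) where

    private
      N = suc n
      K = resolution N k
      κ = fromℕ K

      choice : Fin (2 ℕ.^ N) → Fin N → Fin 2
      choice = Fin.finToFun

      bounded : ∀ p → ∃ (Bounded (slackBound N) {k} {N} {N} {rejected (choice p)} {chosen (choice p)})
      bounded p = normalise (slackBound N)
        (λ a b → sqDist-≤ (element≤2n b _) (element≤2n a _)) (fac p)

      G : ∀ p → Factorization k (rejected (choice p)) (chosen (choice p))
      G p = proj₁ (bounded p)

      rows : ∀ p → Spans (rowData (G p)) (3 ℕ.+ k)
      rows p = spanner (rowData (G p))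

      β : ∀ p → Fin (3 ℕ.+ k) → Fin N
      β p = proj₁ (rows p)

      entry : ∀ p → Fin (3 ℕ.+ k) → Fin k → Carrier
      entry p j i = κ * u (G p) (β p j) i

      rounded : ∀ p j i → Σ[ t ∈ Fin (suc K) ] (fromℕ (Fin.toℕ t) ≤ entry p j i × entry p j i ≤ 1# + fromℕ (Fin.toℕ t))
      rounded p j i = roundDown K (*-nonNeg (fromℕ-nonNeg K) (u-nonNeg (G p) (β p j) i))
        (≤-trans (*-monoˡ-≤ (fromℕ-nonNeg K) (u≤1 (proj₂ (bounded p)) (β p j) i)) (≤-reflexive (*-identityʳ κ)))

      -- The number y itself, so that equal codes agree exactly in the columns 1, y, y²; only U is
      -- rounded.
      rejectedIndex : ∀ p → Fin (3 ℕ.+ k) → Fin (N ℕ.* 2)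
      rejectedIndex p j = Fin.combine (β p j) (Fin.opposite (choice p (β p j)))

      roundedRow : ∀ p → Fin (3 ℕ.+ k) → Fin (suc K ℕ.^ k)
      roundedRow p j = Fin.funToFin (λ i → proj₁ (rounded p j i))

      row : ∀ p → Fin (3 ℕ.+ k) → Fin ((N ℕ.* 2) ℕ.* suc K ℕ.^ k)
      row p j = Fin.combine (rejectedIndex p j) (roundedRow p j)

      encode : Fin (2 ℕ.^ N) → Fin (((N ℕ.* 2) ℕ.* suc K ℕ.^ k) ℕ.^ (3 ℕ.+ k))
      encode p = Fin.funToFin (row p)

      same-row : ∀ {p p′} → encode p ≡ encode p′ → ∀ j →
                 rejectedIndex p j ≡ rejectedIndex p′ j × roundedRow p j ≡ roundedRow p′ j
      same-row {p} {p′} eq j = Fin.combine-injective _ _ _ _ (funToFin-injective {f = row p} {row p′} eq j)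

      same-rejected : ∀ {p p′} → encode p ≡ encode p′ → ∀ j →
                      rejected (choice p) (β p j) ≡ rejected (choice p′) (β p′ j)
      same-rejected eq j = ≡.cong (λ t → suc (Fin.toℕ t)) (proj₁ (same-row eq j))

      same-rounded : ∀ {p p′} → encode p ≡ encode p′ → ∀ j i → proj₁ (rounded p j i) ≡ proj₁ (rounded p′ j i)
      same-rounded eq j = funToFin-injective (proj₂ (same-row eq j))

      near : ∀ {p p′} → encode p ≡ encode p′ → ∀ j i →
             κ * (u (G p) (β p j) i - u (G p′) (β p′ j) i) ≤∣ 1# ∣
      near {p} {p′} eq j i = ≤∣∣-resp (sym (x[y-z]≈xy-xz κ _ _)) refl
        (within-one (proj₁ r) (proj₂ r)
          (≤-trans (≤-reflexive t≈t′) (proj₁ r′)) (≤-trans (proj₂ r′) (≤-reflexive (+-congˡ (sym t≈t′)))))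
        where
        r  = proj₂ (rounded p j i)
        r′ = proj₂ (rounded p′ j i)
        t≈t′ : fromℕ (Fin.toℕ (proj₁ (rounded p j i))) ≈ fromℕ (Fin.toℕ (proj₁ (rounded p′ j i)))
        t≈t′ = reflexive (≡.cong (λ t → fromℕ (Fin.toℕ t)) (same-rounded eq j i))

      -- Where they differ, the number that `p` rejects is a vertex for `p′`, and `distinguished`
      -- bounds `K` by its own predecessor.
      choices-agree : ∀ {p p′} → encode p ≡ encode p′ → ∀ a → choice p a ≡ choice p′ a
      choices-agree {p} {p′} eq a = ¬¬-elim λ differ → ℕ.1+n≰n
        (distinguished (G p) (G p′) (proj₂ (bounded p′)) (rows p) (β p′) (same-rejected eq) (near eq) a a
          (≡.cong (element a) (≢⇒opposite differ)))

      encode-injective : Injective _≡_ _≡_ encode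
      encode-injective {p} {p′} eq = ≡.trans (≡.sym (Fin.funToFin-finToFin {N} {2} p))
        (≡.trans (funToFin-cong (choices-agree eq)) (Fin.funToFin-finToFin {N} {2} p′))

    countingBound : 2 ℕ.^ N ℕ.≤ codeBound N k
    countingBound = Fin.injective⇒≤ encode-injective

-- Square roots and logarithms from suprema.

module Roots (em : ExcludedMiddle 0ℓ) (ℝ : CompleteOrderedField) where
  open OrderedField em ℝ

  sqrt : ∀ {a} → 0# ≤ a → ∃ (IsSqrt a)
  sqrt {a} 0≤a = s , 0≤s , ≤-antisym (≮⇒≥ not-above) (≮⇒≥ not-below)
    where
    S : Pred Carrier 0ℓ
    S x = 0# ≤ x × x * x ≤ a
    bounded-by : ∀ {b} → 0# ≤ b → a ≤ b * b → IsUpperBound S b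
    bounded-by 0≤b a≤bb (_ , xx≤a) = square-cancel-≤ 0≤b (≤-trans xx≤a a≤bb)
    0∈S : S 0#
    0∈S = ≤-refl , ≤-trans (≤-reflexive (zeroˡ 0#)) 0≤a
    1+a-bound : IsUpperBound S (1# + a)
    1+a-bound = bounded-by (+-nonNeg 0≤1 0≤a) (begin
      a                                  ≤⟨ x≤x+y (+-nonNeg (+-nonNeg 0≤1 0≤a) (square-nonNeg a)) ⟩
      a + (1# + a + a * a)               ≈⟨ solve 1 (λ a → a :+ (con (+ 1) :+ a :+ a :* a) := (con (+ 1) :+ a) :* (con (+ 1) :+ a)) refl a ⟩
      (1# + a) * (1# + a)                ∎)
    sup = supremum S (0# , 0∈S) (1# + a , 1+a-bound)
    s = proj₁ sup
    upper : IsUpperBound S s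
    upper = proj₁ (proj₂ sup)
    0≤s : 0# ≤ s
    0≤s = upper 0∈S

    ≮⇒≥ : ∀ {x y} → ¬ x < y → y ≤ x
    ≮⇒≥ {x} {y} x≮y = [ (λ x≤y → ≤-reflexive (sym (Classical.¬¬-elim em λ x≉y → x≮y (x≤y , x≉y)))) , (λ p → p) ]′ (≤-total x y)

    not-below : ¬ s * s < a
    not-below (ss≤a , ss≉a) = ε≉0 (≤-antisym ε≤0 0≤ε)
      where
      g = a - s * s
      -- The summand `g` ensures that ε = g / D is at most 1; then (2s + ε)ε ≤ Dε = g, and s + ε
      -- still has square at most a.
      D = s + s + 1# + g
      0≤g : 0# ≤ g
      0≤g = 0≤y-x ss≤a
      1≤D : 1# ≤ D
      1≤D = ≤-trans (x≤x+y (+-nonNeg (+-nonNeg 0≤s 0≤s) 0≤g))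
        (≤-reflexive (solve 3 (λ o s g → o :+ (s :+ s :+ g) := s :+ s :+ o :+ g) refl 1# s g))
      0≤D : 0# ≤ D
      0≤D = ≤-trans 0≤1 1≤D
      D≉0 : ¬ D ≈ 0#
      D≉0 p = 1≰0 (≤-trans 1≤D (≤-reflexive p))
      ε = g * D ⁻¹
      0≤ε : 0# ≤ ε
      0≤ε = *-nonNeg 0≤g (⁻¹-nonNeg 0≤D D≉0)
      Dε≈g : D * ε ≈ g
      Dε≈g = trans (solve 3 (λ d g i → d :* (g :* i) := d :* i :* g) refl D g (D ⁻¹))
        (trans (*-congʳ (*-inverseʳ D≉0)) (*-identityˡ g))
      ε≉0 : ¬ ε ≈ 0#
      ε≉0 p = ss≉a (begin-equality
        s * s             ≈⟨ solve 2 (λ s a → s :* s := a :- (a :- s :* s)) refl s a ⟩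
        a - g             ≈⟨ +-congˡ (-‿cong (trans (sym Dε≈g) (trans (*-congˡ p) (zeroʳ D)))) ⟩
        a - 0#            ≈⟨ solve 1 (λ a → a :- con (+ 0) := a) refl a ⟩
        a                 ∎)
      ε≤1 : ε ≤ 1#
      ε≤1 = *-cancelˡ-≤ 0≤D D≉0 (begin
        D * ε                     ≈⟨ Dε≈g ⟩
        g                         ≤⟨ x≤x+y (+-nonNeg (+-nonNeg 0≤s 0≤s) 0≤1) ⟩
        g + (s + s + 1#)          ≈⟨ +-comm _ _ ⟩
        s + s + 1# + g            ≈⟨ *-identityʳ D ⟨
        D * 1#                    ∎)
      s+ε∈S : S (s + ε)
      s+ε∈S = +-nonNeg 0≤s 0≤ε , (begin
        (s + ε) * (s + ε)               ≈⟨ solve 2 (λ s e → (s :+ e) :* (s :+ e) := s :* s :+ (s :+ s :+ e) :* e) refl s ε ⟩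
        s * s + (s + s + ε) * ε         ≤⟨ +-monoʳ-≤ (s * s) (*-mono-≤ (+-nonNeg (+-nonNeg 0≤s 0≤s) 0≤ε) 0≤ε
                                              (≤-trans (+-monoʳ-≤ (s + s) ε≤1) (x≤x+y 0≤g)) ≤-refl) ⟩
        s * s + D * ε                   ≈⟨ +-congˡ Dε≈g ⟩
        s * s + g                       ≈⟨ solve 2 (λ s a → s :* s :+ (a :- s :* s) := a) refl s a ⟩
        a                               ∎)
      ε≤0 : ε ≤ 0#
      ε≤0 = ≤-resp-≈ (solve 2 (λ s e → :- s :+ (s :+ e) := e) refl s ε) (-‿inverseˡ s) (+-monoʳ-≤ (- s) (upper s+ε∈S))

    not-above : ¬ a < s * s
    not-above (a≤ss , a≉ss) = g≉0 (≤-antisym g≤0 0≤g)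
      where
      g = s * s - a
      0≤g : 0# ≤ g
      0≤g = 0≤y-x a≤ss
      g≉0 : ¬ g ≈ 0#
      g≉0 p = a≉ss (begin-equality
        a                ≈⟨ solve 2 (λ a t → a := t :- (t :- a)) refl a (s * s) ⟩
        s * s - g        ≈⟨ +-congˡ (-‿cong p) ⟩
        s * s - 0#       ≈⟨ solve 1 (λ t → t :- con (+ 0) := t) refl (s * s) ⟩
        s * s            ∎)
      s≉0 : ¬ s ≈ 0#
      s≉0 p = g≉0 (≤-antisym (begin
        s * s - a        ≈⟨ +-congʳ (trans (*-congʳ p) (zeroˡ s)) ⟩
        0# - a           ≈⟨ +-identityˡ _ ⟩
        - a              ≤⟨ neg-antimono-≤ 0≤a ⟩
        - 0#             ≈⟨ -0#≈0# ⟩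
        0#               ∎) 0≤g)
      T = s + s
      0≤T : 0# ≤ T
      0≤T = +-nonNeg 0≤s 0≤s
      T≉0 : ¬ T ≈ 0#
      T≉0 p = s≉0 (≤-antisym (≤-trans (x≤x+y 0≤s) (≤-reflexive p)) 0≤s)
      -- A Newton step from s. By the inequality of arithmetic and geometric means b² ≥ a, so b
      -- bounds `S`; s ≤ b then gives 2s² ≤ s² + a.
      b = (s * s + a) * T ⁻¹
      0≤b : 0# ≤ b
      0≤b = *-nonNeg (+-nonNeg (square-nonNeg s) 0≤a) (⁻¹-nonNeg 0≤T T≉0)
      Tb≈ : T * b ≈ s * s + a
      Tb≈ = trans (solve 3 (λ t c i → t :* (c :* i) := t :* i :* c) refl T (s * s + a) (T ⁻¹))
        (trans (*-congʳ (*-inverseʳ T≉0)) (*-identityˡ _))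
      a≤bb : a ≤ b * b
      a≤bb = 0≤y-x⇒x≤y (begin
        0#                              ≤⟨ square-nonNeg (s - b) ⟩
        (s - b) * (s - b)               ≈⟨ solve 2 (λ s b → (s :- b) :* (s :- b) := s :* s :+ b :* b :- (s :+ s) :* b) refl s b ⟩
        s * s + b * b - T * b           ≈⟨ +-congˡ (-‿cong Tb≈) ⟩
        s * s + b * b - (s * s + a)     ≈⟨ solve 3 (λ s b a → s :+ b :- (s :+ a) := b :- a) refl (s * s) (b * b) a ⟩
        b * b - a                       ∎)
      s≤b : s ≤ b
      s≤b = proj₂ (proj₂ sup) (bounded-by 0≤b a≤bb)
      g≤0 : g ≤ 0#
      g≤0 = begin
        s * s - a                       ≈⟨ solve 2 (λ s a → s :* s :- a := (s :+ s) :* s :- (s :* s :+ a)) refl s a ⟩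
        T * s - (s * s + a)             ≤⟨ +-monoˡ-≤ _ (*-monoˡ-≤ 0≤T s≤b) ⟩
        T * b - (s * s + a)             ≈⟨ +-congʳ Tb≈ ⟩
        (s * s + a) - (s * s + a)       ≈⟨ -‿inverseʳ _ ⟩
        0#                              ∎

  -- The set contains 0 through p = 0, q = 1, and n bounds it because 2 ^ p ≤ n ^ q ≤ 2 ^ (nq).
  log₂ : ∀ {n} → 1 ℕ.≤ n → ∃ (IsLog₂ n)
  log₂ {n} 1≤n = supremum _ (0# , 0 , 1 , ℕ.≤-refl , ℕ.≤-trans 1≤n (ℕ.≤-reflexive (≡.sym (ℕ.*-identityʳ n))) , zeroˡ _)
    (fromℕ n , λ { {r} (p , q , 1≤q , 2^p≤n^q , rq≈p) → bound r p q 1≤q 2^p≤n^q rq≈p })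
    where
    open Arithmetic using (n≤2^n; 2^-cancel-≤)
    bound : ∀ r p q → 1 ℕ.≤ q → 2 ℕ.^ p ℕ.≤ n ℕ.^ q → r * fromℕ q ≈ fromℕ p → r ≤ fromℕ n
    bound r p q 1≤q 2^p≤n^q rq≈p = *-cancelˡ-≤ (fromℕ-nonNeg q) (fromℕ≉0 1≤q) (begin
      fromℕ q * r           ≈⟨ *-comm _ _ ⟩
      r * fromℕ q           ≈⟨ rq≈p ⟩
      fromℕ p               ≤⟨ fromℕ-mono p≤nq ⟩
      fromℕ (n ℕ.* q)       ≈⟨ fromℕ-* n q ⟩
      fromℕ n * fromℕ q     ≈⟨ *-comm _ _ ⟩
      fromℕ q * fromℕ n     ∎)
      where
      p≤nq : p ℕ.≤ n ℕ.* q
      p≤nq = 2^-cancel-≤ (ℕ.≤-trans 2^p≤n^q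
        (ℕ.≤-trans (ℕ.^-monoˡ-≤ q (n≤2^n n)) (ℕ.≤-reflexive (ℕ.^-*-assoc 2 n q))))

  log₂-≥ : ∀ {n p q ℓ} → 1 ℕ.≤ q → 2 ℕ.^ p ℕ.≤ n ℕ.^ q → IsLog₂ n ℓ → fromℕ p ≤ ℓ * fromℕ q
  log₂-≥ {p = p} {q} {ℓ} 1≤q 2^p≤n^q (upper , _) = begin
    fromℕ p         ≈⟨ rq≈p ⟨
    r * fromℕ q     ≤⟨ *-mono-≤ 0≤r (fromℕ-nonNeg q) (upper (p , q , 1≤q , 2^p≤n^q , rq≈p)) ≤-refl ⟩
    ℓ * fromℕ q     ∎
    where
    r = fromℕ p * fromℕ q ⁻¹
    0≤r : 0# ≤ r
    0≤r = *-nonNeg (fromℕ-nonNeg p) (⁻¹-nonNeg (fromℕ-nonNeg q) (fromℕ≉0 1≤q))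
    rq≈p : r * fromℕ q ≈ fromℕ p
    rq≈p = trans (solve 3 (λ p i q → p :* i :* q := p :* (q :* i)) refl (fromℕ p) (fromℕ q ⁻¹) (fromℕ q))
      (trans (*-congˡ (*-inverseʳ (fromℕ≉0 1≤q))) (*-identityʳ _))

  log₂-nonNeg : ∀ {n ℓ} → 1 ℕ.≤ n → IsLog₂ n ℓ → 0# ≤ ℓ
  log₂-nonNeg {n} 1≤n (upper , _) = upper
    (0 , 1 , ℕ.≤-refl , ℕ.≤-trans 1≤n (ℕ.≤-reflexive (≡.sym (ℕ.*-identityʳ n))) , zeroˡ _)

-- The hardest transversal and the final bound.

module HardPolygon (em : ExcludedMiddle 0ℓ) (ℝ : CompleteOrderedField) where
  open OrderedField em ℝ
  open Faces em ℝ
  open ParabolaPolygon em ℝ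
  open Factorizations em ℝ
  open Factorization
  open Counting em ℝ
  open Roots em ℝ
  open Polytopes ℝ using (HasExtensionComplexity)

  -- Empty sums would make every entry (x - y)² - 1 vanish, but numbers from the first and the third
  -- pair differ by at least 2. Neighbouring pairs may contribute 2 and 3, where the entry is 0.
  innerDimension≢0 : ∀ {n} (f : Fin (3 ℕ.+ n) → Fin 2) → ¬ Factorization 0 (rejected f) (chosen f)
  innerDimension≢0 {n} f F = ℕ.<⇒≱ {1} {2 ℕ.* 2} (ℕ.s≤s (ℕ.s≤s ℕ.z≤n)) (fromℕ-cancel-≤ (begin
    fromℕ (2 ℕ.* 2)                    ≈⟨ fromℕ-* 2 2 ⟩
    fromℕ 2 * fromℕ 2                  ≤⟨ sqDist-gap 2 far ⟩
    sqDist x y                         ≈⟨ solve 2 (λ s o → s := s :- o :+ o) refl (sqDist x y) 1# ⟩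
    sqDist x y - 1# + 1#               ≈⟨ +-congʳ (product F zero (suc (suc zero))) ⟨
    0# + 1#                            ≈⟨ +-comm 0# 1# ⟩
    fromℕ 1                            ∎))
    where
    x = chosen f (suc (suc zero))
    y = rejected f zero
    far : 2 ℕ.+ y ℕ.≤ x
    far = ℕ.s≤s (ℕ.≤-trans (ℕ.+-monoʳ-≤ 1 y≤2)
      (ℕ.≤-trans (ℕ.m≤m+n 3 _) (ℕ.≤-reflexive (≡.sym (Fin.toℕ-combine {3 ℕ.+ n} (suc (suc zero)) (f (suc (suc zero))))))))
      where
      y≤2 : y ℕ.≤ 2
      y≤2 = ℕ.≤-trans (ℕ.≤-reflexive (≡.cong suc (Fin.toℕ-combine {3 ℕ.+ n} zero (Fin.opposite (f zero)))))
                      (Fin.toℕ<n (Fin.opposite (f zero)))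

  argmaxℕ : ∀ {m} → Fin m → (g : Fin m → ℕ) → ∃[ i ] (∀ j → g j ℕ.≤ g i)
  argmaxℕ {suc m} _ g = let i , max = argmax (λ j → fromℕ (g j)) in i , λ j → fromℕ-cancel-≤ (max j)

  -- No threshold for k is fixed in advance: k is the largest complexity among the 2ⁿ polygons, and
  -- all factorisations are padded to it before counting.
  hardestChoice : ∀ {n} → 3 ℕ.≤ n →
    (xc : ∀ p → ∃ (HasExtensionComplexity (polygon (chosen (Fin.finToFun {2} {n} p))))) →
    ∃[ p ] (1 ℕ.≤ proj₁ (xc p) × 2 ℕ.^ n ℕ.≤ n ℕ.^ (36 ℕ.* (proj₁ (xc p) ℕ.* proj₁ (xc p))))
  hardestChoice {n@(suc (suc (suc m)))} 3≤n@(ℕ.s≤s (ℕ.s≤s (ℕ.s≤s _))) xc = p , 1≤k ,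
    Arithmetic.codeBound⇒exponentialBound {n} 3≤n {k} 1≤k (countingBound {suc (suc m)} {k} padded)
    where
    hardest : ∃[ p ] (∀ p′ → proj₁ (xc p′) ℕ.≤ proj₁ (xc p))
    hardest = argmaxℕ (Fin.funToFin {n} {2} (λ _ → zero)) (λ p → proj₁ (xc p))
    p = proj₁ hardest
    k = proj₁ (xc p)
    choice : Fin (2 ℕ.^ n) → Fin n → Fin 2
    choice = Fin.finToFun
    factorization : ∀ p → Factorization (proj₁ (xc p)) (rejected (choice p)) (chosen (choice p))
    factorization p = extension⇒factorization (chosen≢rejected (choice p)) (proj₁ (proj₂ (xc p)))
    padded : ∀ p → Factorization k (rejected (choice p)) (chosen (choice p))
    padded p′ = pad (ℕ.≤⇒≤′ (proj₂ hardest p′)) (factorization p′)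
    1≤k : 1 ℕ.≤ k
    1≤k = ℕ.n≢0⇒n>0 λ k≡0 → innerDimension≢0 (choice p)
      (≡.subst (λ k → Factorization k (rejected (choice p)) (chosen (choice p))) k≡0 (factorization p))

  hardPolygon : ∀ {n} → 3 ℕ.≤ n → Σ[ f ∈ (Fin n → Fin 2) ] ∃[ k ]
    (HasExtensionComplexity (polygon (chosen f)) k × 1 ℕ.≤ k × 2 ℕ.^ n ℕ.≤ n ℕ.^ (36 ℕ.* (k ℕ.* k)))
  hardPolygon {n} 3≤n =
    let p , 1≤k , 2^n≤ = hardestChoice 3≤n xc
    in Fin.finToFun p , proj₁ (xc p) , proj₂ (xc p) , 1≤k , 2^n≤
    where
    xc : ∀ p → ∃ (HasExtensionComplexity (polygon (chosen (Fin.finToFun {2} {n} p))))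
    xc p = hasExtensionComplexity (polygon (chosen (Fin.finToFun p)))

  -- The hypothesis says n ≤ 36k² log₂ n, so √n ≤ 6k √(log₂ n). As n ≥ 1, it also excludes log₂ n =
  -- 0, which makes the division meaningful.
  lowerBound : ∀ {n k r ℓ s} → 1 ℕ.≤ n → 1 ℕ.≤ k → 2 ℕ.^ n ℕ.≤ n ℕ.^ (36 ℕ.* (k ℕ.* k)) →
    IsSqrt (fromℕ n) r → IsLog₂ n ℓ → IsSqrt ℓ s → fromℕ 6 ⁻¹ * (r * s ⁻¹) ≤ fromℕ k
  lowerBound {n} {k} {r} {ℓ} {s} 1≤n 1≤k 2^n≤ (0≤r , rr≈n) log (0≤s , ss≈ℓ) =
    *-cancelˡ-≤ (fromℕ-nonNeg 6) 6≉0 (begin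
      fromℕ 6 * (fromℕ 6 ⁻¹ * (r * s ⁻¹))
        ≈⟨ trans (sym (*-assoc _ _ _)) (trans (*-congʳ (*-inverseʳ 6≉0)) (*-identityˡ _)) ⟩
      r * s ⁻¹
        ≤⟨ *-mono-≤ 0≤r (⁻¹-nonNeg 0≤s s≉0) r≤6ks ≤-refl ⟩
      fromℕ 6 * fromℕ k * s * s ⁻¹
        ≈⟨ trans (*-assoc _ _ _) (trans (*-congˡ (*-inverseʳ s≉0)) (*-identityʳ _)) ⟩
      fromℕ 6 * fromℕ k ∎)
    where
    6≉0 : ¬ fromℕ 6 ≈ 0#
    6≉0 = fromℕ≉0 {6} (ℕ.s≤s ℕ.z≤n)
    1≤36kk : 1 ℕ.≤ 36 ℕ.* (k ℕ.* k)
    1≤36kk = ℕ.*-mono-≤ {1} {36} (ℕ.s≤s ℕ.z≤n) (ℕ.*-mono-≤ 1≤k 1≤k)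
    n≤36kkℓ : fromℕ n ≤ ℓ * fromℕ (36 ℕ.* (k ℕ.* k))
    n≤36kkℓ = log₂-≥ {n} {n} {36 ℕ.* (k ℕ.* k)} 1≤36kk 2^n≤ log
    s≉0 : ¬ s ≈ 0#
    s≉0 s≈0 = fromℕ≉0 1≤n (≤-antisym (≤-trans n≤36kkℓ (≤-reflexive
      (trans (*-congʳ (trans (sym ss≈ℓ) (trans (*-congʳ s≈0) (zeroˡ s)))) (zeroˡ _)))) (fromℕ-nonNeg n))
    r≤6ks : r ≤ fromℕ 6 * fromℕ k * s
    r≤6ks = square-cancel-≤ (*-nonNeg (*-nonNeg (fromℕ-nonNeg 6) (fromℕ-nonNeg k)) 0≤s) (begin
      r * r
        ≈⟨ rr≈n ⟩
      fromℕ n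
        ≤⟨ n≤36kkℓ ⟩
      ℓ * fromℕ (36 ℕ.* (k ℕ.* k))
        ≈⟨ *-cong (sym ss≈ℓ) (trans (fromℕ-* 36 (k ℕ.* k)) (*-cong (fromℕ-* 6 6) (fromℕ-* k k))) ⟩
      s * s * (fromℕ 6 * fromℕ 6 * (fromℕ k * fromℕ k))
        ≈⟨ solve 3 (λ s a k → s :* s :* (a :* a :* (k :* k)) := a :* k :* s :* (a :* k :* s)) refl s (fromℕ 6) (fromℕ k) ⟩
      fromℕ 6 * fromℕ k * s * (fromℕ 6 * fromℕ k * s) ∎)

theorem8 : ExcludedMiddle 0ℓ →
    (ℝ : CompleteOrderedField) →
    let open CompleteOrderedField ℝ
        open Polytopes ℝ
    in
    ∃[ c ] (0# < c ×
      (∀ (n : ℕ) → 3 ℕ.≤ n →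
        Σ[ P ∈ Polytope 2 ]
          ( IsConvexGon n P
          × (∀ {v} → IsVertex P v → InGrid (2 ℕ.* n) (4 ℕ.* n ℕ.^ 2) v)
          × ∃[ k ] (HasExtensionComplexity P k ×
              ∃[ √n ] ∃[ log-n ] ∃[ √log-n ]
                ( IsSqrt (fromℕ n) √n
                × IsLog₂ n log-n
                × IsSqrt log-n √log-n
                × c * (√n * √log-n ⁻¹) ≤ fromℕ k)))))
theorem8 em ℝ = fromℕ 6 ⁻¹ , (⁻¹-nonNeg (fromℕ-nonNeg 6) 6≉0 , 0≉6⁻¹) , λ n 3≤n →
  let f , k , xc , 1≤k , 2^n≤ = hardPolygon 3≤n
      1≤n     = ℕ.≤-trans (ℕ.s≤s ℕ.z≤n) 3≤n
      r , r√n = sqrt (fromℕ-nonNeg n)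
      ℓ , log = log₂ 1≤n
      s , s√ℓ = sqrt {ℓ} (log₂-nonNeg 1≤n log)
  in polygon (chosen f) , isConvexGon (chosen f) 3≤n (chosen-injective f) ,
     vertices-inGrid (chosen f) (λ i → ℕ.s≤s ℕ.z≤n ,
       ℕ.≤-trans (element≤2n i (f i)) (ℕ.≤-reflexive (ℕ.*-comm n 2))) ,
     k , xc , r , ℓ , s , r√n , log , s√ℓ , lowerBound {n} {k} 1≤n 1≤k 2^n≤ r√n log s√ℓ
  where
  open OrderedField em ℝ
  open ParabolaPolygon em ℝ
  open Counting em ℝ
  open Roots em ℝ
  open HardPolygon em ℝ
  6≉0 : ¬ fromℕ 6 ≈ 0#
  6≉0 = fromℕ≉0 {6} (ℕ.s≤s ℕ.z≤n)
  0≉6⁻¹ : ¬ 0# ≈ fromℕ 6 ⁻¹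
  0≉6⁻¹ p = 0≉1 (trans (sym (trans (*-congˡ (sym p)) (zeroʳ _))) (*-inverseʳ 6≉0))
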